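{- Let $\alpha\ge 2$ be an integer, $\varepsilon\in(0,1/2]$, let $X\subset\mathbb{R}$ be a set of $n\ge 1$ keys and let $q\in\mathbb{R}\setminus X$. Let $\pi$ be a uniformly random priority permutation of $X$ and let $T_X(\pi)$ be the $(\alpha,\varepsilon)$-Randomized Block Search Tree on $X$. Let $D_q$ be the number of primary tree nodes of $T_X(\pi)$ that have $q$ in their interval. Then $$\mathbb{E}[D_q]\le 5\log_\alpha n .$$ Moreover, the expected number of secondary tree nodes (those with fan-out bound $\delta<\alpha+1$) that have $q$ in their interval is $O(1/\varepsilon)$. In particular, the expected number of blocks in the search path of $q$ is $O(\varepsilon^{ -1}+\log_\alpha n)$. (The constants hidden in $O(\cdot)$ are absolute.)
   Context: $(\alpha,\varepsilon)$-RBST. Fix an integer $\alpha\ge1$ and a real $\varepsilon\in(0,1/2]$. Put $\rho=108\alpha/\varepsilon$ and $\beta=(\alpha+1)\rho$; the parameters are assumed to be such that $\beta$ is an integer. For an integer $s\ge0$ define the fan-out bound $\delta(s)=\min\{\alpha+1,\max\{1,\lceil (s-\alpha)/\rho\rceil\}\}$. Let $X$ be a set of $n$ distinct keys from a totally ordered universe and let $\pi:X\to\{1,\dots,n\}$ be a bijection (the priorities), drawn uniformly at random. The tree $T_X(\pi)$ is a rooted tree of blocks, each holding at most $\alpha$ keys, defined recursively for any subset $Y\subseteq X$, $|Y|=s$, arising in the construction (starting with $Y=X$): if $Y=\emptyset$ there is no block; otherwise the root block of the subtree for $Y$ stores the $\min\{\alpha,s\}$ keys of $Y$ of smallest priority.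 If $s\le\alpha$ this is the only block of the subtree. If $s>\alpha$, the $\delta(s)-1$ keys of smallest priority in $Y$ are the active separators of this block; the remaining $s-\alpha$ keys (those not stored in the block) are partitioned by the active separators, in key order, into $\delta(s)$ (possibly empty) sections, and the subtree of each non-empty section, built recursively, becomes a child of the block. The interval $(\ell(v),r(v))$ of a block $v$ is the open interval between the two consecutive active separators of ancestors of $v$ that delimit the section of $v$ (endpoints $\pm\infty$ where there is no such separator; if the parent has no active separators, the interval equals that of the parent). A block whose subtree contains $s$ keys is a primary tree node if $\delta(s)=\alpha+1$ and a secondary tree node if $\delta(s)<\alpha+1$. The search path of $q$ consists of the blocks whose interval contains $q$. -}

module Defs where

open import Level using (Level)
open import Data.Fin.Base using (Fin; zero; suc; punchIn)
open import Data.Fin.Properties using () renaming (_≟_ to _≟ᶠ_)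
open import Data.Fin.Permutation
  using (Permutation′; _⟨$⟩ʳ_; _⟨$⟩ˡ_; _≈_; id; insert; remove; insert-remove)
import Data.Integer.Base as ℤ
open import Data.List.Base
  using (List; []; _∷_; _++_; length; map; filter; take; drop; tabulate;
         mapMaybe; concatMap; allFin)
import Data.List.Properties as List
open import Data.List.Membership.Propositional.Properties using (∈-allFin)
open import Data.List.Relation.Unary.Any as Any using (Any; here)
import Data.List.Relation.Unary.Any.Properties as Any
import Data.List.Sort as Sort
open import Data.Maybe.Base using (Maybe; just; nothing; maybe′)
open import Data.Nat.Base
  using (ℕ; zero; suc; _+_; _*_; _∸_; _^_; _≤_; _<_; NonZero; >-nonZero⁻¹; _!)
open import Data.Nat.ListAction using (sum)
import Data.Nat.Properties as ℕ
open import Data.Product.Base using (_×_; _,_; ∃-syntax)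
open import Data.Rational.Base as ℚ using (ℚ; ½; Positive; ↥_; ↧ₙ_; ceiling)
import Data.Rational.Properties as ℚ
open import Function.Base using (_∘_)
open import Relation.Binary.Bundles using (StrictTotalOrder)
import Relation.Binary.Construct.Add.Extrema.Strict as Extrema
import Relation.Binary.Properties.StrictTotalOrder as StrictTotalOrderProperties
open import Relation.Binary.PropositionalEquality
  using (_≡_; refl; sym; trans; cong; cong₂; module ≡-Reasoning)
open import Relation.Nullary.Decidable using (Dec; yes; no; _×-dec_)
open import Relation.Unary using (Decidable)

------------------------------------------------------------------------
-- Uniformly random permutations

permutations : ∀ n → List (Permutation′ n)
permutations zero    = id ∷ []
permutations (suc n) =
  concatMap (λ j → map (insert zero j) (permutations n)) (allFin (suc n))

-- The next two facts show that each permutation is listed exactly once.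

permutations-complete : ∀ {n} (π : Permutation′ n) → Any (π ≈_) (permutations n)
permutations-complete {zero}  π = here λ ()
permutations-complete {suc n} π =
  Any.concatMap⁺ (λ j → map (insert zero j) (permutations n))
    (Any.map (λ { refl → Any.map⁺ (Any.map reinsert (permutations-complete (remove zero π))) })
      (∈-allFin (π ⟨$⟩ʳ zero)))
  where
  insert-cong : ∀ j {σ τ : Permutation′ n} → σ ≈ τ → insert zero j σ ≈ insert zero j τ
  insert-cong j σ≈τ k with zero ≟ᶠ k
  ... | yes _ = refl
  ... | no  _ = cong (punchIn j) (σ≈τ _)

  reinsert : ∀ {σ} → remove zero π ≈ σ → π ≈ insert zero (π ⟨$⟩ʳ zero) σ
  reinsert {σ} eq k = trans (sym (insert-remove zero π k))
                            (insert-cong (π ⟨$⟩ʳ zero) {remove zero π} {σ} eq k)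

length-permutations : ∀ n → length (permutations n) ≡ n !
length-permutations zero    = refl
length-permutations (suc n) =
  trans (lemma (allFin (suc n)))
        (cong (_* n !) (List.length-tabulate {n = suc n} (λ i → i)))
  where
  open ≡-Reasoning
  lemma : ∀ js → length (concatMap (λ j → map (insert zero j) (permutations n)) js)
                 ≡ length js * n !
  lemma []       = refl
  lemma (j ∷ js) = trans
    (List.length-++ (map (insert zero j) (permutations n)))
    (cong₂ _+_ (trans (List.length-map (insert zero j) (permutations n)) (length-permutations n))
               (lemma js))

𝔼 : ∀ {n} → (Permutation′ n → ℕ) → ℚ
𝔼 {n} f = (ℤ.+ sum (map f (permutations n)) ℚ./ n !) {{n ℕ.!≢0}}

------------------------------------------------------------------------
-- Comparison of a rational with a multiple of a logarithm

-- For b ≥ 2, n ≥ 1 and x = p / d with d > 0:  x ≤ c · log_b n  iff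
-- p ≤ log_b (n ^ (c d))  iff  b ^ p ≤ n ^ (c d).  If p is negative, then
-- b ^ p is moved to the other side as b ^ (- p).

infix 4 _≤_·log[_]_

_≤_·log[_]_ : ℚ → ℕ → ℕ → ℕ → Set
x ≤ c ·log[ b ] n with ↥ x
... | ℤ.+ p       = b ^ p ≤ n ^ (c * ↧ₙ x)
... | ℤ.-[1+ p ]  = 1 ≤ n ^ (c * ↧ₙ x) * b ^ suc p

------------------------------------------------------------------------
-- Parameters

-- The field β∈ℤ forces the real number ε to be rational.

record Parameters : Set where
  field
    α              : ℕ
    {{α-nonZero}}  : NonZero α
    ε              : ℚ
    {{ε-positive}} : Positive ε
    ε≤½            : ε ℚ.≤ ½

  1/ε : ℚ
  1/ε = (ℚ.1/ ε) {{ℚ.pos⇒nonZero ε}}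

  ρ : ℚ
  ρ = (ℤ.+ (108 * α) ℚ./ 1) ℚ.* 1/ε

  β : ℚ
  β = (ℤ.+ (α + 1) ℚ./ 1) ℚ.* ρ

  field
    β∈ℤ : ∃[ b ] β ≡ b ℚ./ 1

  ρ-positive : Positive ρ
  ρ-positive = ℚ.pos*pos⇒pos (ℤ.+ (108 * α) ℚ./ 1) {{108α-positive}} 1/ε {{ℚ.1/pos⇒pos ε}}
    where
    108α-positive : Positive (ℤ.+ (108 * α) ℚ./ 1)
    108α-positive = ℚ.normalize-pos (108 * α) 1 {{_}} {{ℕ.m*n≢0 108 α}}

  δ : ℕ → ℕ
  δ s = ℤ.∣ ℤ.+ (α + 1) ℤ.⊓ (ℤ.+ 1 ℤ.⊔ ceiling (s-α ℚ.÷ ρ)) ∣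
    where
    instance _ = ℚ.pos⇒nonZero ρ {{ρ-positive}}
    s-α = (ℤ.+ s ℤ.- ℤ.+ α) ℚ./ 1

  Primary Secondary : ℕ → Set
  Primary   s = δ s ≡ α + 1
  Secondary s = δ s < α + 1

------------------------------------------------------------------------
-- The randomized block search tree

module RBST {k ℓ₁ ℓ₂ : Level} (O : StrictTotalOrder k ℓ₁ ℓ₂) (P : Parameters) where

  open Parameters P
  open StrictTotalOrder O using () renaming (Carrier to Key; _<?_ to _<ᵏ?_; _<_ to _<ᵏ_)
  open import Data.Tree.AVL.Key O using (Key⁺; [_]; ⊥⁺; ⊤⁺; _<_<_)
  open Sort (StrictTotalOrderProperties.decTotalOrder O) using (sort)

  -- The open interval between two elements of the universe extended
  -- by ±∞.

  Interval : Set k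
  Interval = Key⁺ × Key⁺

  _∈ᴵ_ : Key → Interval → Set _
  x ∈ᴵ (l , r) = l < x < r

  _∈ᴵ?_ : ∀ x I → Dec (x ∈ᴵ I)
  x ∈ᴵ? (l , r) = (l <⁺? [ x ]) ×-dec ([ x ] <⁺? r)
    where _<⁺?_ = Extrema.<±-dec _<ᵏ_ _<ᵏ?_

  -- The intervals into which increasing separators cut an interval.

  gaps : Interval → List Key → List Interval
  gaps (l , r) []       = (l , r) ∷ []
  gaps (l , r) (x ∷ xs) = (l , [ x ]) ∷ gaps ([ x ] , r) xs

  record Block : Set k where
    field
      interval    : Interval
      stored      : List Key
      subtreeKeys : List Key

    size : ℕ
    size = length subtreeKeys

  open Block

  data Tree : Set k where
    node : Block → List Tree → Tree

  blocks  : Tree → List Block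
  blocks* : List Tree → List Block
  blocks (node b ts) = b ∷ blocks* ts
  blocks* []         = []
  blocks* (t ∷ ts)   = blocks t ++ blocks* ts

  -- A set Y of keys is given as the list of its elements in order of
  -- increasing priority: take j Y are the j keys of smallest priority,
  -- and filtering preserves this convention. The bound m on the size of
  -- Y serves only to make the recursion structural.

  build : ∀ m (Y : List Key) → .(length Y ≤ m) → Interval → Maybe Tree
  build _       []        _   _ = nothing
  build (suc m) Y@(_ ∷ _) Y≤m I with length Y ℕ.≤? α
  ... | yes _ = just (node (record { interval = I ; stored = take α Y ; subtreeKeys = Y }) [])
  ... | no  _ = just (node (record { interval = I ; stored = take α Y ; subtreeKeys = Y })
                           (mapMaybe child (gaps I (sort separators))))
    where
    separators = take (δ (length Y) ∸ 1) Y
    rest       = drop α Y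

    rest≤m : length Y ≤ suc m → length rest ≤ m
    rest≤m Y≤ = begin
      length rest     ≡⟨ List.length-drop α Y ⟩
      length Y ∸ α    ≤⟨ ℕ.∸-mono Y≤ (>-nonZero⁻¹ α) ⟩
      suc m ∸ 1       ≡⟨⟩
      m               ∎
      where open ℕ.≤-Reasoning

    child : Interval → Maybe Tree
    child J = build m (filter (_∈ᴵ? J) rest)
                    (ℕ.≤-trans (List.length-filter (_∈ᴵ? J) rest) (rest≤m Y≤m)) J

  -- X enumerates the n keys, and π maps the index of a key to its
  -- priority (counted from 0).

  keysByPriority : ∀ {n} → (Fin n → Key) → Permutation′ n → List Key
  keysByPriority X π = tabulate (λ p → X (π ⟨$⟩ˡ p))

  tree : ∀ {n} → (Fin n → Key) → Permutation′ n → Maybe Tree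
  tree {n} X π = build n (keysByPriority X π)
                       (ℕ.≤-reflexive (List.length-tabulate (λ p → X (π ⟨$⟩ˡ p))))
                       (⊥⁺ , ⊤⁺)

  searchPath : ∀ {n} → (Fin n → Key) → Key → Permutation′ n → List Block
  searchPath X q π =
    filter (λ b → q ∈ᴵ? interval b) (maybe′ blocks [] (tree X π))

  primary? : Decidable (Primary ∘ size)
  primary? b = δ (size b) ℕ.≟ α + 1

  secondary? : Decidable (Secondary ∘ size)
  secondary? b = δ (size b) ℕ.<? α + 1

  #primary #secondary #blocks : ∀ {n} → (Fin n → Key) → Key → Permutation′ n → ℕ
  #primary   X q π = length (filter primary?   (searchPath X q π))
  #secondary X q π = length (filter secondary? (searchPath X q π))
  #blocks    X q π = length (searchPath X q π)

module Submission where

-- The sums run over all orderings of a list of keys, so that everything is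
-- an inequality between natural numbers. Two facts about a uniformly random
-- ordering suffice. The relative order of the keys in a section is uniform
-- again, which allows induction on the tree. And by exchangeability, each of
-- the first j + 1 keys is equally likely to come last among them, while at
-- most two of them are next to q; hence after j picks from s keys the section
-- of q has expected size at most 2 s / (j + 1).
--
-- A primary block has j = α, so the size s of the section shrinks by the
-- factor 2 / (α + 1) in expectation. A primary block also has s > 216 α², so
-- by induction the number D of primary blocks satisfies
-- E [max (D - K) 0] ≤ s (2 / (α + 1)) ^ K / (72 α²) for every K, and
-- K ≈ 2 log_α n gives E [D] ≤ K + 1. A secondary block leads to a section of
-- expected size O(ρ), and below it every block but the last removes α keys,
-- so O(ρ / α) = O(1 / ε) blocks remain.

open import Level using (Level)
import Algebra.Properties.CommutativeSemigroup as CommutativeSemigroupProperties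
open import Data.Bool.Base using (if_then_else_; true; false)
open import Data.Fin.Base as Fin using (Fin; punchOut)
open import Data.Fin.Permutation using (Permutation′; _⟨$⟩ˡ_; insert)
import Data.Fin.Properties as Fin
import Data.Integer.Base as ℤ
import Data.Integer.DivMod as ℤ
import Data.Integer.Properties as ℤ
open import Data.List.Base
  using (List; []; _∷_; _++_; length; map; filter; take; drop; tabulate; mapMaybe; concatMap; allFin)
import Data.List.Properties as List
open import Data.List.Membership.Propositional using (_∈_)
open import Data.List.Relation.Binary.Permutation.Propositional
  using (_↭_; ↭-refl; ↭-sym; ↭-trans; ↭-prep; ↭-swap)
open import Data.List.Relation.Binary.Permutation.Propositional.Properties
  using (↭-length; ↭-empty-inv; All-resp-↭; ∈-resp-↭; filter-↭)
open import Data.List.Relation.Unary.All as All using (All; []; _∷_; all?)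
import Data.List.Relation.Unary.All.Properties as All
open import Data.List.Relation.Unary.AllPairs using (AllPairs; []; _∷_)
open import Data.List.Relation.Unary.Any using (here; there)
open import Data.List.Relation.Unary.Sorted.TotalOrder.Properties using (Sorted⇒AllPairs)
import Data.List.Sort as Sort
open import Data.Maybe.Base using (Maybe; just; nothing; maybe′)
open import Data.Nat.Base hiding (_/_)
open import Data.Nat.ListAction using (sum)
open import Data.Nat.ListAction.Properties using (sum-++)
open import Data.Nat.Properties
open import Data.Nat.Tactic.RingSolver using (solve-∀)
open import Data.Product.Base using (_×_; _,_; proj₁; proj₂; ∃-syntax; Σ-syntax)
open import Data.Rational.Base as ℚ
  using (ℚ; mkℚ; _/_; ↥_; ↧_; ↧ₙ_; ceiling; floor; toℚᵘ)
import Data.Rational.Properties as ℚ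
open import Data.Rational.Unnormalised.Base as ℚᵘ using (mkℚᵘ; *≡*; *≤*)
import Data.Rational.Unnormalised.Properties as ℚᵘ
open import Data.Sum.Base using (_⊎_; inj₁; inj₂)
open import Data.Vec.Functional using (insertAt)
open import Data.Vec.Functional.Properties using (insertAt-lookup; insertAt-punchIn)
open import Function.Base using (_∘_; id)
open import Function.Definitions using (Injective)
open import Relation.Binary.Bundles using (StrictTotalOrder; DecTotalOrder)
import Relation.Binary.Construct.Add.Extrema.Strict as Extrema
open import Relation.Binary.Definitions using (tri<; tri≈; tri>)
open import Relation.Binary.PropositionalEquality
  using (_≡_; refl; sym; trans; cong; cong₂; subst; subst₂; module ≡-Reasoning)
import Relation.Binary.Properties.StrictTotalOrder as StrictTotalOrderProperties
import Relation.Binary.Reasoning.Setoid as SetoidReasoning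
open import Relation.Nullary using (¬_; Dec; yes; no; does; contradiction)
open import Relation.Nullary.Decidable using (dec-true; dec-false; ¬?; _×-dec_; _⊎-dec_)
open import Relation.Unary using (Pred; Decidable)
open import Defs

-- Sums over orderings

-- The intermediate bounds are linear in `s` on purpose. A bound such as E [D] ≤ C log s would have
-- to pass through the random size of the section, hence use concavity of the logarithm; a linear
-- bound passes through by linearity alone. The excess over `K` keeps this linearity and still
-- counts only the primary blocks after the first `K`. The logarithm appears only in the choice of
-- `K`. Its factor 2 is there because 2 / (α + 1) is at most 1 / √α, but exceeds 1 / α for α ≥ 2.
-- All bounds are stated for every interval and every list of keys, so the subtree of a section
-- falls under the same statement as the whole tree. Factorials replace probabilities: a pick `ys`
-- with rest `zs` stands for `length zs !` orderings.

module ℕ+ = CommutativeSemigroupProperties +-commutativeSemigroup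
module ℕ* = CommutativeSemigroupProperties *-commutativeSemigroup

private variable
  a p : Level
  A : Set a

𝟙 : {P : Set p} → Dec P → ℕ
𝟙 d = if does d then 1 else 0

-- ∑sel f xs is the sum of f y ys over all ways to remove one element y
-- from xs, leaving ys.

∑sel : (A → List A → ℕ) → List A → ℕ
∑sel f []       = 0
∑sel f (x ∷ xs) = f x xs + ∑sel (λ y ys → f y (x ∷ ys)) xs

∑sel-mono : ∀ {f g : A → List A → ℕ} xs →
  (∀ y ys → y ∷ ys ↭ xs → f y ys ≤ g y ys) → ∑sel f xs ≤ ∑sel g xs
∑sel-mono []       f≤g = z≤n
∑sel-mono (x ∷ xs) f≤g =
  +-mono-≤ (f≤g x xs ↭-refl)
    (∑sel-mono xs λ y ys eq → f≤g y (x ∷ ys) (↭-trans (↭-swap y x ↭-refl) (↭-prep x eq)))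

∑sel-cong : ∀ {f g : A → List A → ℕ} xs →
  (∀ y ys → y ∷ ys ↭ xs → f y ys ≡ g y ys) → ∑sel f xs ≡ ∑sel g xs
∑sel-cong xs f≡g = ≤-antisym
  (∑sel-mono xs λ y ys eq → ≤-reflexive (f≡g y ys eq))
  (∑sel-mono xs λ y ys eq → ≤-reflexive (sym (f≡g y ys eq)))

∑sel-+ : ∀ (f g : A → List A → ℕ) xs →
  ∑sel (λ y ys → f y ys + g y ys) xs ≡ ∑sel f xs + ∑sel g xs
∑sel-+ f g []       = refl
∑sel-+ f g (x ∷ xs)
  rewrite ∑sel-+ (λ y ys → f y (x ∷ ys)) (λ y ys → g y (x ∷ ys)) xs =
  ℕ+.interchange (f x xs) (g x xs) _ _

∑sel-* : ∀ c (f : A → List A → ℕ) xs → ∑sel (λ y ys → c * f y ys) xs ≡ c * ∑sel f xs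
∑sel-* c f []       = sym (*-zeroʳ c)
∑sel-* c f (x ∷ xs) = trans
  (cong (c * f x xs +_) (∑sel-* c (λ y ys → f y (x ∷ ys)) xs))
  (sym (*-distribˡ-+ c (f x xs) _))

∑sel-const : ∀ c (xs : List A) → ∑sel (λ _ _ → c) xs ≡ length xs * c
∑sel-const c []       = refl
∑sel-const c (x ∷ xs) = cong (c +_) (∑sel-const c xs)

∑sel-swap : ∀ (f : A → A → List A → ℕ) xs →
  ∑sel (λ x xs′ → ∑sel (λ y ys → f x y ys) xs′) xs ≡
  ∑sel (λ y xs′ → ∑sel (λ x ys → f x y ys) xs′) xs
∑sel-swap f []       = refl
∑sel-swap f (z ∷ xs) = begin
  ∑sel (f z) xs + ∑sel (λ x xs′ → f x z xs′ + ∑sel (λ y ys → f x y (z ∷ ys)) xs′) xs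
    ≡⟨ cong (∑sel (f z) xs +_) (∑sel-+ (λ x xs′ → f x z xs′) _ xs) ⟩
  ∑sel (f z) xs + (∑sel (λ x → f x z) xs + ∑sel (λ x xs′ → ∑sel (λ y ys → f x y (z ∷ ys)) xs′) xs)
    ≡⟨ cong (λ t → ∑sel (f z) xs + (∑sel (λ x → f x z) xs + t)) (∑sel-swap (λ x y ys → f x y (z ∷ ys)) xs) ⟩
  ∑sel (f z) xs + (∑sel (λ x → f x z) xs + ∑sel (λ y xs′ → ∑sel (λ x ys → f x y (z ∷ ys)) xs′) xs)
    ≡⟨ ℕ+.x∙yz≈y∙xz (∑sel (f z) xs) (∑sel (λ x → f x z) xs) _ ⟩
  ∑sel (λ x → f x z) xs + (∑sel (f z) xs + ∑sel (λ y xs′ → ∑sel (λ x ys → f x y (z ∷ ys)) xs′) xs)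
    ≡⟨ cong (∑sel (λ x → f x z) xs +_) (∑sel-+ (f z) _ xs) ⟨
  ∑sel (λ x → f x z) xs + ∑sel (λ y xs′ → f z y xs′ + ∑sel (λ x ys → f x y (z ∷ ys)) xs′) xs ∎
  where
  open ≡-Reasoning

∑sel-𝟙 : ∀ {P : Pred A p} (P? : Decidable P) c xs →
  ∑sel (λ y _ → 𝟙 (P? y) * c) xs ≡ length (filter P? xs) * c
∑sel-𝟙 P? c []       = refl
∑sel-𝟙 P? c (x ∷ xs) with does (P? x)
... | true  = cong₂ _+_ (+-identityʳ c) (∑sel-𝟙 P? c xs)
... | false = ∑sel-𝟙 P? c xs

-- ∑ins x f ys is the sum of f over all ways to insert x into ys, and
-- ∑ord f xs is the sum of f over all orderings of xs.

∑ins : A → (List A → ℕ) → List A → ℕ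
∑ins x f []       = f (x ∷ [])
∑ins x f (y ∷ ys) = f (x ∷ y ∷ ys) + ∑ins x (f ∘ (y ∷_)) ys

∑ord : (List A → ℕ) → List A → ℕ
∑ord f []       = f []
∑ord f (x ∷ xs) = ∑ord (∑ins x f) xs

∑ins-mono : ∀ x {f g : List A → ℕ} ys →
  (∀ zs → zs ↭ x ∷ ys → f zs ≤ g zs) → ∑ins x f ys ≤ ∑ins x g ys
∑ins-mono x []       f≤g = f≤g (x ∷ []) ↭-refl
∑ins-mono x (y ∷ ys) f≤g = +-mono-≤ (f≤g _ ↭-refl)
  (∑ins-mono x ys λ zs zs↭ → f≤g (y ∷ zs) (↭-trans (↭-prep y zs↭) (↭-swap y x ↭-refl)))

∑ord-mono : ∀ {f g : List A → ℕ} xs → (∀ ys → ys ↭ xs → f ys ≤ g ys) → ∑ord f xs ≤ ∑ord g xs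
∑ord-mono []       f≤g = f≤g [] ↭-refl
∑ord-mono (x ∷ xs) f≤g = ∑ord-mono xs λ ys ys↭ →
  ∑ins-mono x ys λ zs zs↭ → f≤g zs (↭-trans zs↭ (↭-prep x ys↭))

∑ord-cong : ∀ {f g : List A → ℕ} xs → (∀ ys → ys ↭ xs → f ys ≡ g ys) → ∑ord f xs ≡ ∑ord g xs
∑ord-cong xs f≡g = ≤-antisym
  (∑ord-mono xs λ ys eq → ≤-reflexive (f≡g ys eq))
  (∑ord-mono xs λ ys eq → ≤-reflexive (sym (f≡g ys eq)))

∑ins-+ : ∀ x (f g : List A → ℕ) ys →
  ∑ins x (λ zs → f zs + g zs) ys ≡ ∑ins x f ys + ∑ins x g ys
∑ins-+ x f g []       = refl
∑ins-+ x f g (y ∷ ys) rewrite ∑ins-+ x (f ∘ (y ∷_)) (g ∘ (y ∷_)) ys =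
  ℕ+.interchange (f (x ∷ y ∷ ys)) (g (x ∷ y ∷ ys)) _ _

∑ord-+ : ∀ (f g : List A → ℕ) xs → ∑ord (λ ys → f ys + g ys) xs ≡ ∑ord f xs + ∑ord g xs
∑ord-+ f g []       = refl
∑ord-+ f g (x ∷ xs) = trans
  (∑ord-cong xs λ ys _ → ∑ins-+ x f g ys) (∑ord-+ (∑ins x f) (∑ins x g) xs)

∑ins-* : ∀ c x (f : List A → ℕ) ys → ∑ins x (λ zs → c * f zs) ys ≡ c * ∑ins x f ys
∑ins-* c x f []       = refl
∑ins-* c x f (y ∷ ys) = trans
  (cong (c * f (x ∷ y ∷ ys) +_) (∑ins-* c x (f ∘ (y ∷_)) ys))
  (sym (*-distribˡ-+ c (f (x ∷ y ∷ ys)) _))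

∑ord-* : ∀ c (f : List A → ℕ) xs → ∑ord (λ ys → c * f ys) xs ≡ c * ∑ord f xs
∑ord-* c f []       = refl
∑ord-* c f (x ∷ xs) = trans
  (∑ord-cong xs λ ys _ → ∑ins-* c x f ys) (∑ord-* c (∑ins x f) xs)

∑ins-const : ∀ c (x : A) ys → ∑ins x (λ _ → c) ys ≡ suc (length ys) * c
∑ins-const c x []       = sym (+-identityʳ c)
∑ins-const c x (y ∷ ys) = cong (c +_) (∑ins-const c x ys)

∑ord-const : ∀ c (xs : List A) → ∑ord (λ _ → c) xs ≡ c * length xs !
∑ord-const c []       = sym (*-identityʳ c)
∑ord-const c (x ∷ xs) = begin
  ∑ord (∑ins x (λ _ → c)) xs
    ≡⟨ ∑ord-cong xs (λ ys ys↭ → trans (∑ins-const c x ys) (cong (λ l → suc l * c) (↭-length ys↭))) ⟩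
  ∑ord (λ _ → suc (length xs) * c) xs
    ≡⟨ ∑ord-const _ xs ⟩
  suc (length xs) * c * length xs !
    ≡⟨ cong (_* length xs !) (*-comm (suc (length xs)) c) ⟩
  c * suc (length xs) * length xs !
    ≡⟨ *-assoc c (suc (length xs)) _ ⟩
  c * suc (length xs) ! ∎
  where open ≡-Reasoning

-- Either `x` stays first, or some `y` of `xs` is first and `x` is inserted after it. This passes
-- from the insertions that define `∑ord` to draws in order of priority, the order in which the tree
-- reads the keys.
∑ord-∷ : ∀ (f : List A → ℕ) x xs →
  ∑ord f (x ∷ xs) ≡ ∑sel (λ y ys → ∑ord (f ∘ (y ∷_)) ys) (x ∷ xs)
∑ord-∷ f x []             = sym (+-identityʳ _)
∑ord-∷ {A = A} f x xs@(z ∷ zs) = begin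
  ∑ord (∑ins x f) xs
    ≡⟨ ∑ord-∷ (∑ins x f) z zs ⟩
  ∑sel (λ y ys → ∑ord (λ ws → f (x ∷ y ∷ ws) + ∑ins x (f ∘ (y ∷_)) ws) ys) xs
    ≡⟨ ∑sel-cong xs (λ y ys _ → ∑ord-+ (λ ws → f (x ∷ y ∷ ws)) (∑ins x (f ∘ (y ∷_))) ys) ⟩
  ∑sel (λ y ys → ∑ord (λ ws → f (x ∷ y ∷ ws)) ys + ∑ord (f ∘ (y ∷_)) (x ∷ ys)) xs
    ≡⟨ ∑sel-+ (λ y ys → ∑ord (λ ws → f (x ∷ y ∷ ws)) ys) (λ y ys → ∑ord (f ∘ (y ∷_)) (x ∷ ys)) xs ⟩
  ∑sel (λ y ys → ∑ord (λ ws → f (x ∷ y ∷ ws)) ys) xs + ∑sel (λ y ys → ∑ord (f ∘ (y ∷_)) (x ∷ ys)) xs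
    ≡⟨ cong (_+ ∑sel (λ y ys → ∑ord (f ∘ (y ∷_)) (x ∷ ys)) xs) (∑ord-∷ (f ∘ (x ∷_)) z zs) ⟨
  ∑ord (f ∘ (x ∷_)) xs + ∑sel (λ y ys → ∑ord (f ∘ (y ∷_)) (x ∷ ys)) xs ∎
  where open ≡-Reasoning

-- ∑pick j f xs is the sum of f ys zs over all ways to pick from xs a
-- sequence ys of j elements, leaving zs.

∑pick : ℕ → (List A → List A → ℕ) → List A → ℕ
∑pick zero    f xs = f [] xs
∑pick (suc j) f xs = ∑sel (λ x → ∑pick j (λ ys → f (x ∷ ys))) xs

∑pick-mono : ∀ j {f g : List A → List A → ℕ} xs →
  (∀ ys zs → length ys ≡ j → j + length zs ≡ length xs → f ys zs ≤ g ys zs) →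
  ∑pick j f xs ≤ ∑pick j g xs
∑pick-mono zero    xs f≤g = f≤g [] xs refl refl
∑pick-mono (suc j) xs f≤g = ∑sel-mono xs λ x xs′ eq → ∑pick-mono j xs′ λ ys zs eq₁ eq₂ →
  f≤g (x ∷ ys) zs (cong suc eq₁) (trans (cong suc eq₂) (↭-length eq))

∑pick-cong : ∀ j {f g : List A → List A → ℕ} xs →
  (∀ ys zs → length ys ≡ j → j + length zs ≡ length xs → f ys zs ≡ g ys zs) →
  ∑pick j f xs ≡ ∑pick j g xs
∑pick-cong j xs f≡g = ≤-antisym
  (∑pick-mono j xs λ ys zs eq₁ eq₂ → ≤-reflexive (f≡g ys zs eq₁ eq₂))
  (∑pick-mono j xs λ ys zs eq₁ eq₂ → ≤-reflexive (sym (f≡g ys zs eq₁ eq₂)))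

∑pick-+ : ∀ j (f g : List A → List A → ℕ) xs →
  ∑pick j (λ ys zs → f ys zs + g ys zs) xs ≡ ∑pick j f xs + ∑pick j g xs
∑pick-+ zero    f g xs = refl
∑pick-+ (suc j) f g xs = trans
  (∑sel-cong xs λ x xs′ _ → ∑pick-+ j (λ ys → f (x ∷ ys)) (λ ys → g (x ∷ ys)) xs′)
  (∑sel-+ _ _ xs)

∑pick-* : ∀ j c (f : List A → List A → ℕ) xs →
  ∑pick j (λ ys zs → c * f ys zs) xs ≡ c * ∑pick j f xs
∑pick-* zero    c f xs = refl
∑pick-* (suc j) c f xs = trans
  (∑sel-cong xs λ x xs′ _ → ∑pick-* j c (λ ys → f (x ∷ ys)) xs′) (∑sel-* c _ xs)

-- An equality as long as `j ≤ length xs`; a longer pick makes the left side an empty sum, so the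
-- inequality holds for every `j`.
∑pick-! : ∀ j (xs : List A) → ∑pick j (λ _ zs → length zs !) xs ≤ length xs !
∑pick-! zero    xs       = ≤-refl
∑pick-! (suc j) []       = z≤n
∑pick-! (suc j) (x ∷ xs) = begin
  ∑sel (λ _ → ∑pick j (λ _ zs → length zs !)) (x ∷ xs)
    ≤⟨ ∑sel-mono (x ∷ xs) (λ y ys eq →
         ≤-trans (∑pick-! j ys) (≤-reflexive (cong _! (suc-injective (↭-length eq))))) ⟩
  ∑sel (λ _ _ → length xs !) (x ∷ xs)
    ≡⟨ ∑sel-const (length xs !) (x ∷ xs) ⟩
  suc (length xs) ! ∎
  where open ≤-Reasoning

∑ord-pick : ∀ j (f : List A → ℕ) xs → j ≤ length xs →
  ∑ord f xs ≡ ∑pick j (λ ys → ∑ord (f ∘ (ys ++_))) xs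
∑ord-pick zero    f xs       _         = refl
∑ord-pick (suc j) f (x ∷ xs) (s≤s j≤) = trans (∑ord-∷ f x xs)
  (∑sel-cong (x ∷ xs) λ y ys eq →
    ∑ord-pick j (f ∘ (y ∷_)) ys (≤-trans j≤ (≤-reflexive (sym (suc-injective (↭-length eq))))))

-- Exchangeability: the element drawn after the first j picks may change
-- places with any of them.

∑pick-next : ∀ j (f : A → List A → List A → ℕ) xs →
  suc j * ∑pick j (λ ys → ∑sel (λ z → f z ys)) xs ≡
  ∑pick (suc j) (λ ys zs → ∑sel (λ y ys′ → f y ys′ zs) ys) xs
∑pick-next j f xs = trans (cong (suc j *_) (draw-first j f xs)) (sym (move-first j f xs))
  where
  open ≡-Reasoning

  -- Repeated swaps of neighbouring draws carry the last drawn element to the front.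
  draw-first : ∀ j (f : A → List A → List A → ℕ) xs →
    ∑pick j (λ ys → ∑sel (λ z → f z ys)) xs ≡ ∑sel (λ z → ∑pick j (f z)) xs
  draw-first zero    f xs = refl
  draw-first (suc j) f xs = trans
    (∑sel-cong xs λ x xs′ _ → draw-first j (λ z ys → f z (x ∷ ys)) xs′)
    (∑sel-swap (λ x z → ∑pick j (λ ys → f z (x ∷ ys))) xs)

  -- Each of the `suc j` positions of the special element contributes the same sum as the first
  -- position.
  move-first : ∀ j (f : A → List A → List A → ℕ) xs →
    ∑pick (suc j) (λ ys zs → ∑sel (λ y ys′ → f y ys′ zs) ys) xs ≡
    suc j * ∑sel (λ z → ∑pick j (f z)) xs
  move-first zero    f xs = trans
    (∑sel-cong xs λ x xs′ _ → +-identityʳ (f x [] xs′)) (sym (+-identityʳ _))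
  move-first (suc j) f xs = begin
    ∑sel (λ x → ∑pick (suc j) (λ ys zs → f x ys zs + ∑sel (λ y ys′ → f y (x ∷ ys′) zs) ys)) xs
      ≡⟨ ∑sel-cong xs (λ x xs′ _ → ∑pick-+ (suc j) (f x) (λ ys zs → ∑sel (λ y ys′ → f y (x ∷ ys′) zs) ys) xs′) ⟩
    ∑sel (λ x xs′ → ∑pick (suc j) (f x) xs′ +
                    ∑pick (suc j) (λ ys zs → ∑sel (λ y ys′ → f y (x ∷ ys′) zs) ys) xs′) xs
      ≡⟨ ∑sel-+ (λ x → ∑pick (suc j) (f x)) _ xs ⟩
    F + ∑sel (λ x → ∑pick (suc j) (λ ys zs → ∑sel (λ y ys′ → f y (x ∷ ys′) zs) ys)) xs
      ≡⟨ cong (F +_) (∑sel-cong xs λ x xs′ _ → move-first j (λ y ys → f y (x ∷ ys)) xs′) ⟩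
    F + ∑sel (λ x xs′ → suc j * ∑sel (λ y → ∑pick j (λ ys → f y (x ∷ ys))) xs′) xs
      ≡⟨ cong (F +_) (∑sel-* (suc j) _ xs) ⟩
    F + suc j * ∑sel (λ x xs′ → ∑sel (λ y → ∑pick j (λ ys → f y (x ∷ ys))) xs′) xs
      ≡⟨ cong (λ t → F + suc j * t) (∑sel-swap (λ x y → ∑pick j (λ ys → f y (x ∷ ys))) xs) ⟩
    F + suc j * F ∎
    where F = ∑sel (λ z → ∑pick (suc j) (f z)) xs

-- The relative order of the elements satisfying P is again uniform.

module _ {P : Pred A p} (P? : Decidable P) where

  -- Removing an element outside `P` leaves the filtered list unchanged, so `g` contributes once for
  -- each of the `length xs - length (filter P? xs)` rejected elements. Moving the subtrahend to the
  -- left keeps the identity in ℕ.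
  ∑sel-filter : ∀ (f : A → List A → ℕ) (g : List A → ℕ) xs →
    ∑sel (λ y ys → if does (P? y) then f y (filter P? ys) else g (filter P? ys)) xs
      + length (filter P? xs) * g (filter P? xs) ≡
    ∑sel f (filter P? xs) + length xs * g (filter P? xs)
  ∑sel-filter f g []       = refl
  ∑sel-filter f g (x ∷ xs) with does (P? x)
  ... | true = begin
    f x F + S + suc l * c
      ≡⟨ lemma₀ (f x F) S l c ⟩
    f x F + c + (S + l * c)
      ≡⟨ cong (f x F + c +_) (∑sel-filter (λ y ys → f y (x ∷ ys)) (g ∘ (x ∷_)) xs) ⟩
    f x F + c + (T + length xs * c)
      ≡⟨ lemma (f x F) c T (length xs) ⟩
    f x F + T + suc (length xs) * c ∎
    where
    open ≡-Reasoning
    F = filter P? xs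
    l = length F
    c = g (x ∷ F)
    S = ∑sel (λ y ys → if does (P? y) then f y (x ∷ filter P? ys) else g (x ∷ filter P? ys)) xs
    T = ∑sel (λ y ys → f y (x ∷ ys)) F
    lemma₀ : ∀ a s l c → a + s + suc l * c ≡ a + c + (s + l * c)
    lemma₀ = solve-∀
    lemma : ∀ a c t n → a + c + (t + n * c) ≡ a + t + suc n * c
    lemma = solve-∀
  ... | false = begin
    c + S + l * c
      ≡⟨ +-assoc c S _ ⟩
    c + (S + l * c)
      ≡⟨ cong (c +_) (∑sel-filter f g xs) ⟩
    c + (T + length xs * c)
      ≡⟨ lemma c T (length xs) ⟩
    T + suc (length xs) * c ∎
    where
    open ≡-Reasoning
    F = filter P? xs
    l = length F
    c = g F
    S = ∑sel (λ y ys → if does (P? y) then f y (filter P? ys) else g (filter P? ys)) xs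
    T = ∑sel f F
    lemma : ∀ c t n → c + (t + n * c) ≡ t + suc n * c
    lemma = solve-∀

  -- Every ordering of the filtered list is induced by equally many orderings of `xs`, namely
  -- `length xs ! / length (filter P? xs) !`; the identity is this count multiplied out. The
  -- induction splits on whether the first element drawn is kept.
  ∑ord-filter : ∀ (f : List A → ℕ) xs →
    length (filter P? xs) ! * ∑ord (f ∘ filter P?) xs ≡ length xs ! * ∑ord f (filter P? xs)
  ∑ord-filter f xs = go (length xs) f xs refl
    where
    open ≡-Reasoning

    go : ∀ n (f : List A → ℕ) xs → length xs ≡ n →
      length (filter P? xs) ! * ∑ord (f ∘ filter P?) xs ≡ n ! * ∑ord f (filter P? xs)
    go zero    f []          eq = refl
    go (suc n) f xs@(x ∷ xs₁) eq with filter P? xs in eqF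
    ... | [] = begin
      1 * ∑ord (f ∘ filter P?) xs
        ≡⟨ *-identityˡ _ ⟩
      ∑ord (f ∘ filter P?) xs
        ≡⟨ ∑ord-cong xs (λ ys ys↭ → cong f (↭-empty-inv
             (subst (filter P? ys ↭_) eqF (filter-↭ P? ys↭)))) ⟩
      ∑ord (λ _ → f []) xs
        ≡⟨ ∑ord-const (f []) xs ⟩
      f [] * length xs !
        ≡⟨ cong (λ n → f [] * n !) eq ⟩
      f [] * suc n !
        ≡⟨ *-comm (f []) _ ⟩
      suc n ! * f [] ∎
    -- Of the `suc n` possible first elements, the `l` kept ones contribute `l * c` together and
    -- each rejected one contributes `c`, in total `suc n * c`. Adding `l * c` on both sides gives
    -- the form of `∑sel-filter`.
    ... | F@(z ∷ zs) = +-cancelʳ-≡ (l * c) _ _ (begin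
      l ! * ∑ord (f ∘ filter P?) xs + l * c
        ≡⟨ cong (λ t → l ! * t + l * c) (∑ord-∷ (f ∘ filter P?) x xs₁) ⟩
      l ! * ∑sel (λ y → ∑ord (f ∘ filter P? ∘ (y ∷_))) xs + l * c
        ≡⟨ cong (_+ l * c) (∑sel-* (l !) (λ y → ∑ord (f ∘ filter P? ∘ (y ∷_))) xs) ⟨
      ∑sel (λ y ys → l ! * ∑ord (f ∘ filter P? ∘ (y ∷_)) ys) xs + l * c
        ≡⟨ cong (_+ l * c) (∑sel-cong xs step) ⟩
      ∑sel (λ y ys → if does (P? y) then h y (filter P? ys) else n ! * ∑ord f (filter P? ys)) xs + l * c
        ≡⟨ subst (λ G → ∑sel (λ y ys → if does (P? y) then h y (filter P? ys) else n ! * ∑ord f (filter P? ys)) xs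
                   + length G * (n ! * ∑ord f G) ≡ ∑sel h G + length xs * (n ! * ∑ord f G))
             eqF (∑sel-filter h (λ ys → n ! * ∑ord f ys) xs) ⟩
      ∑sel h F + length xs * c
        ≡⟨ cong₂ (λ s n → s + n * c) ∑h eq ⟩
      l * c + suc n * c
        ≡⟨ +-comm (l * c) _ ⟩
      suc n * c + l * c
        ≡⟨ cong (_+ l * c) (*-assoc (suc n) (n !) _) ⟨
      suc n ! * ∑ord f F + l * c ∎)
      where
      l = length F
      c = n ! * ∑ord f F
      h : A → List A → ℕ
      h y ys = l * (n ! * ∑ord (f ∘ (y ∷_)) ys)

      ∑h : ∑sel h F ≡ l * c
      ∑h = begin
        ∑sel h F
          ≡⟨ ∑sel-* l (λ y ys → n ! * ∑ord (f ∘ (y ∷_)) ys) F ⟩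
        l * ∑sel (λ y ys → n ! * ∑ord (f ∘ (y ∷_)) ys) F
          ≡⟨ cong (l *_) (∑sel-* (n !) (λ y → ∑ord (f ∘ (y ∷_))) F) ⟩
        l * (n ! * ∑sel (λ y → ∑ord (f ∘ (y ∷_))) F)
          ≡⟨ cong (λ t → l * (n ! * t)) (∑ord-∷ f z zs) ⟨
        l * c ∎

      step : ∀ y ys → y ∷ ys ↭ xs → l ! * ∑ord (f ∘ filter P? ∘ (y ∷_)) ys ≡
        (if does (P? y) then h y (filter P? ys) else n ! * ∑ord f (filter P? ys))
      step y ys ↭xs with ih ← go n | size ← trans (↭-length (filter-↭ P? ↭xs)) (cong length eqF)
                    | len ← suc-injective (trans (↭-length ↭xs) eq) | does (P? y)
      ... | true  = begin
        l * length zs ! * ∑ord (f ∘ (y ∷_) ∘ filter P?) ys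
          ≡⟨ *-assoc l (length zs !) _ ⟩
        l * (length zs ! * ∑ord (f ∘ (y ∷_) ∘ filter P?) ys)
          ≡⟨ cong (λ n → l * (n ! * ∑ord (f ∘ (y ∷_) ∘ filter P?) ys)) (suc-injective size) ⟨
        l * (length (filter P? ys) ! * ∑ord (f ∘ (y ∷_) ∘ filter P?) ys)
          ≡⟨ cong (l *_) (ih (f ∘ (y ∷_)) ys len) ⟩
        h y (filter P? ys) ∎
      ... | false = trans
        (cong (λ n → n ! * ∑ord (f ∘ filter P?) ys) (sym size)) (ih f ys len)

  -- Hypothesis and conclusion bound the same mean by `b / c`, because `∑ord-filter` identifies the
  -- two means.
  ∑ord-filter-≤ : ∀ c b (f : List A → ℕ) xs →
    c * ∑ord f (filter P? xs) ≤ b * length (filter P? xs) ! →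
    c * ∑ord (f ∘ filter P?) xs ≤ b * length xs !
  ∑ord-filter-≤ c b f xs bound = *-cancelˡ-≤ (l !) {{l !≢0}} (begin
    l ! * (c * ∑ord (f ∘ filter P?) xs)
      ≡⟨ ℕ*.x∙yz≈y∙xz (l !) c _ ⟩
    c * (l ! * ∑ord (f ∘ filter P?) xs)
      ≡⟨ cong (c *_) (∑ord-filter f xs) ⟩
    c * (length xs ! * ∑ord f (filter P? xs))
      ≡⟨ ℕ*.x∙yz≈y∙xz c (length xs !) _ ⟩
    length xs ! * (c * ∑ord f (filter P? xs))
      ≤⟨ *-monoʳ-≤ (length xs !) bound ⟩
    length xs ! * (b * l !)
      ≡⟨ ℕ*.x∙yz≈z∙yx (length xs !) b (l !) ⟩
    l ! * (b * length xs !) ∎)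
    where
    l = length (filter P? xs)
    open ≤-Reasoning

-- Expected size of a section

𝟙≤ : {P : Set p} (d : Dec P) {n : ℕ} → (P → 1 ≤ n) → 𝟙 d ≤ n
𝟙≤ (yes p) 1≤n = 1≤n p
𝟙≤ (no _)  _   = z≤n

𝟙-no : {P : Set p} (d : Dec P) → ¬ P → 𝟙 d ≡ 0
𝟙-no d ¬p rewrite dec-false d ¬p = refl

𝟙-yes : {P : Set p} (d : Dec P) → P → 𝟙 d ≡ 1
𝟙-yes d p rewrite dec-true d p = refl

-- Two elements that dominate all the others would dominate each other, against asymmetry. So at
-- most one summand is 1.
∑sel-dominating : ∀ {_≻_ : A → A → Set p} (_≻?_ : ∀ x y → Dec (x ≻ y)) →
  (∀ {x y} → x ≻ y → ¬ (y ≻ x)) →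
  ∀ xs → ∑sel (λ y ys → 𝟙 (all? (y ≻?_) ys)) xs ≤ 1
∑sel-dominating _≻?_ asym []       = z≤n
∑sel-dominating _≻?_ asym (x ∷ xs) with all? (x ≻?_) xs
... | no  _  = ≤-trans
  (∑sel-mono xs λ y ys _ → 𝟙-mono-tail y ys)
  (∑sel-dominating _≻?_ asym xs)
  where
  𝟙-mono-tail : ∀ y ys → 𝟙 (all? (y ≻?_) (x ∷ ys)) ≤ 𝟙 (all? (y ≻?_) ys)
  𝟙-mono-tail y ys with does (y ≻? x)
  ... | true  = ≤-refl
  ... | false = z≤n
... | yes x≻ = s≤s (≤-reflexive (trans (∑sel-cong {g = λ _ _ → 0} xs λ y ys y∷ys↭ →
    𝟙-no (all? (y ≻?_) (x ∷ ys)) λ { (y≻x ∷ _) →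
      asym y≻x (All.head (All-resp-↭ (↭-sym y∷ys↭) x≻)) })
  (trans (∑sel-const 0 xs) (*-zeroʳ (length xs)))))

-- Counting the keys of a section amounts to drawing one more key `z`, which `∑pick-next` puts on a
-- par with the `j` picks. The predicate `J` stays abstract: of the order of the keys only the bound
-- 2 on the neighbours enters.
section-size : ∀ (J : List A → Pred A p) (J? : ∀ ys → Decidable (J ys)) →
  (∀ ys → ∑sel (λ y ys′ → 𝟙 (J? ys′ y)) ys ≤ 2) →
  ∀ j xs → suc j * ∑pick j (λ ys zs → length (filter (J? ys) zs) * length zs !) xs ≤
           2 * (length xs * length xs !)
section-size J J? ∑J≤2 j xs = begin
  suc j * ∑pick j (λ ys zs → length (filter (J? ys) zs) * length zs !) xs
    ≤⟨ *-monoʳ-≤ (suc j) (∑pick-mono j xs λ ys zs _ eq → step ys zs (m+n≤o⇒n≤o j (≤-reflexive eq))) ⟩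
  suc j * ∑pick j (λ ys zs → n * ∑sel (λ z zs′ → 𝟙 (J? ys z) * length zs′ !) zs) xs
    ≡⟨ cong (suc j *_) (∑pick-* j n _ xs) ⟩
  suc j * (n * ∑pick j (λ ys → ∑sel (λ z zs′ → 𝟙 (J? ys z) * length zs′ !)) xs)
    ≡⟨ ℕ*.x∙yz≈y∙xz (suc j) n _ ⟩
  n * (suc j * ∑pick j (λ ys → ∑sel (λ z zs′ → 𝟙 (J? ys z) * length zs′ !)) xs)
    ≡⟨ cong (n *_) (∑pick-next j (λ z ys zs′ → 𝟙 (J? ys z) * length zs′ !) xs) ⟩
  n * ∑pick (suc j) (λ ys zs → ∑sel (λ y ys′ → 𝟙 (J? ys′ y) * length zs !) ys) xs
    ≤⟨ *-monoʳ-≤ n (∑pick-mono (suc j) xs λ ys zs _ _ → neighbours ys (length zs !)) ⟩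
  n * ∑pick (suc j) (λ _ zs → 2 * length zs !) xs
    ≡⟨ cong (n *_) (∑pick-* (suc j) 2 (λ _ zs → length zs !) xs) ⟩
  n * (2 * ∑pick (suc j) (λ _ zs → length zs !) xs)
    ≤⟨ *-monoʳ-≤ n (*-monoʳ-≤ 2 (∑pick-! (suc j) xs)) ⟩
  n * (2 * n !)
    ≡⟨ ℕ*.x∙yz≈y∙xz n 2 (n !) ⟩
  2 * (n * n !) ∎
  where
  open ≤-Reasoning
  n = length xs

  -- The next draw splits the factor `length zs` off the factorial, and this factor is bounded by
  -- `n`.
  step : ∀ ys zs → length zs ≤ n → length (filter (J? ys) zs) * length zs ! ≤
         n * ∑sel (λ z zs′ → 𝟙 (J? ys z) * length zs′ !) zs
  step ys []          _    = z≤n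
  step ys zs@(_ ∷ zs₁) zs≤n = begin
    length (filter (J? ys) zs) * (length zs * length zs₁ !)
      ≡⟨ ℕ*.x∙yz≈y∙xz (length (filter (J? ys) zs)) (length zs) (length zs₁ !) ⟩
    length zs * (length (filter (J? ys) zs) * length zs₁ !)
      ≡⟨ cong (length zs *_) (∑sel-𝟙 (J? ys) (length zs₁ !) zs) ⟨
    length zs * ∑sel (λ z _ → 𝟙 (J? ys z) * length zs₁ !) zs
      ≡⟨ cong (length zs *_) (∑sel-cong zs λ z zs′ eq →
           cong (λ l → 𝟙 (J? ys z) * l !) (sym (suc-injective (↭-length eq)))) ⟩
    length zs * ∑sel (λ z zs′ → 𝟙 (J? ys z) * length zs′ !) zs
      ≤⟨ *-monoˡ-≤ _ zs≤n ⟩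
    n * ∑sel (λ z zs′ → 𝟙 (J? ys z) * length zs′ !) zs ∎

  neighbours : ∀ ys c → ∑sel (λ y ys′ → 𝟙 (J? ys′ y) * c) ys ≤ 2 * c
  neighbours ys c = begin
    ∑sel (λ y ys′ → 𝟙 (J? ys′ y) * c) ys
      ≡⟨ ∑sel-cong ys (λ y ys′ _ → *-comm (𝟙 (J? ys′ y)) c) ⟩
    ∑sel (λ y ys′ → c * 𝟙 (J? ys′ y)) ys
      ≡⟨ ∑sel-* c _ ys ⟩
    c * ∑sel (λ y ys′ → 𝟙 (J? ys′ y)) ys
      ≤⟨ *-monoʳ-≤ c (∑J≤2 ys) ⟩
    c * 2
      ≡⟨ *-comm c 2 ⟩
    2 * c ∎

-- Rational numbers and the fan-out bound

module _ where

  open import Data.Integer.Base using (ℤ; +_; -[1+_]; ∣_∣)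

  ↥≤*↧⇒≤ : ∀ p k → ↥ p ℤ.≤ k ℤ.* ↧ p → p ℚ.≤ k ℚ./ 1
  ↥≤*↧⇒≤ p@record{} k le = ℚ.toℚᵘ-cancel-≤ (begin
    toℚᵘ p            ≤⟨ *≤* (subst (ℤ._≤ k ℤ.* ↧ p) (sym (ℤ.*-identityʳ (↥ p))) le) ⟩
    mkℚᵘ k 0          ≃⟨ ℚ.toℚᵘ-fromℚᵘ (mkℚᵘ k 0) ⟨
    toℚᵘ (k ℚ./ 1)    ∎)
    where open ℚᵘ.≤-Reasoning

  ≤⇒↥≤*↧ : ∀ p k → p ℚ.≤ k ℚ./ 1 → ↥ p ℤ.≤ k ℤ.* ↧ p
  ≤⇒↥≤*↧ p@record{} k p≤k = subst (ℤ._≤ k ℤ.* ↧ p) (ℤ.*-identityʳ (↥ p)) (ℚᵘ.drop-*≤* (begin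
    toℚᵘ p            ≤⟨ ℚ.toℚᵘ-mono-≤ p≤k ⟩
    toℚᵘ (k ℚ./ 1)    ≃⟨ ℚ.toℚᵘ-fromℚᵘ (mkℚᵘ k 0) ⟩
    mkℚᵘ k 0          ∎))
    where open ℚᵘ.≤-Reasoning

  ceiling≤⇒≤ : ∀ p k → ceiling p ℤ.≤ k → p ℚ.≤ k ℚ./ 1
  ceiling≤⇒≤ p@record{} k le = ↥≤*↧⇒≤ p k (ℤ.neg-cancel-≤ (begin
    ℤ.- (k ℤ.* ↧ p)            ≡⟨ ℤ.neg-distribˡ-* k (↧ p) ⟩
    ℤ.- k ℤ.* ↧ p              ≤⟨ ℤ.*-monoʳ-≤-nonNeg (↧ p) -k≤ ⟩
    floor (ℚ.- p) ℤ.* ↧ p      ≡⟨ cong (floor (ℚ.- p) ℤ.*_) (ℚ.↧-neg p) ⟨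
    floor (ℚ.- p) ℤ.* ↧ (ℚ.- p) ≤⟨ floor*↧≤↥ (ℚ.- p) ⟩
    ↥ (ℚ.- p)                  ≡⟨ ℚ.↥-neg p ⟩
    ℤ.- (↥ p)                  ∎))
    where
    open ℤ.≤-Reasoning
    floor*↧≤↥ : ∀ q → floor q ℤ.* ↧ q ℤ.≤ ↥ q
    floor*↧≤↥ q@record{} = ℤ.[n/d]*d≤n (↥ q) (↧ q)
    -k≤ : ℤ.- k ℤ.≤ floor (ℚ.- p)
    -k≤ = subst (ℤ.- k ℤ.≤_) (ℤ.neg-involutive _) (ℤ.neg-mono-≤ le)

  ≤⇒ceiling≤ : ∀ p k → p ℚ.≤ k ℚ./ 1 → ceiling p ℤ.≤ k
  ≤⇒ceiling≤ p@record{} k le = subst (ceiling p ℤ.≤_) (ℤ.neg-involutive k)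
    (ℤ.neg-mono-≤ (≤floor (ℚ.- p) (begin
      ℤ.- k ℤ.* ↧ (ℚ.- p)  ≡⟨ cong (ℤ.- k ℤ.*_) (ℚ.↧-neg p) ⟩
      ℤ.- k ℤ.* ↧ p        ≡⟨ ℤ.neg-distribˡ-* k (↧ p) ⟨
      ℤ.- (k ℤ.* ↧ p)      ≤⟨ ℤ.neg-mono-≤ (≤⇒↥≤*↧ p k le) ⟩
      ℤ.- (↥ p)            ≡⟨ ℚ.↥-neg p ⟨
      ↥ (ℚ.- p)            ∎)))
    where
    open ℤ.≤-Reasoning
    ≤floor : ∀ q {i} → i ℤ.* ↧ q ℤ.≤ ↥ q → i ℤ.≤ floor q
    ≤floor (mkℚ n d-1 _) {i} le = subst (i ℤ.≤_)
        (trans (ℤ.pred-suc (n ℤ./ℕ suc d-1)) (sym (ℤ.div-pos-is-/ℕ n (suc d-1))))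
        (ℤ.i<j⇒i≤pred[j] (ℤ.*-cancelʳ-<-nonNeg {i} {ℤ.suc (n ℤ./ℕ suc d-1)} (+ suc d-1)
          (ℤ.≤-<-trans le (ℤ.n<s[n/ℕd]*d n (suc d-1)))))

  /1-*-≃ : ∀ k r → toℚᵘ ((k ℚ./ 1) ℚ.* r) ℚᵘ.≃ mkℚᵘ (k ℤ.* ↥ r) (ℚ.denominator-1 r)
  /1-*-≃ k r@(mkℚ n d-1 _) = begin
    toℚᵘ ((k ℚ./ 1) ℚ.* r)          ≈⟨ ℚ.toℚᵘ-homo-* (k ℚ./ 1) r ⟩
    toℚᵘ (k ℚ./ 1) ℚᵘ.* toℚᵘ r      ≈⟨ ℚᵘ.*-congʳ {toℚᵘ r} (ℚ.toℚᵘ-fromℚᵘ (mkℚᵘ k 0)) ⟩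
    mkℚᵘ k 0 ℚᵘ.* toℚᵘ r            ≈⟨ *≡* (cong (λ d → k ℤ.* n ℤ.* + suc d) (sym (+-identityʳ d-1))) ⟩
    mkℚᵘ (k ℤ.* n) d-1 ∎
    where open SetoidReasoning ℚᵘ.≃-setoid

  /≤/1*⇒ : ∀ i k r n .{{_ : NonZero n}} → (i ℚ./ n) ℚ.≤ (k ℚ./ 1) ℚ.* r → i ℤ.* ↧ r ℤ.≤ k ℤ.* ↥ r ℤ.* + n
  /≤/1*⇒ i k r@record{} (suc n-1) le = ℚᵘ.drop-*≤* (begin
    mkℚᵘ i n-1                                ≃⟨ ℚ.toℚᵘ-fromℚᵘ (mkℚᵘ i n-1) ⟨
    toℚᵘ (i ℚ./ suc n-1)                      ≤⟨ ℚ.toℚᵘ-mono-≤ le ⟩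
    toℚᵘ ((k ℚ./ 1) ℚ.* r)                    ≃⟨ /1-*-≃ k r ⟩
    mkℚᵘ (k ℤ.* ↥ r) (ℚ.denominator-1 r)      ∎)
    where open ℚᵘ.≤-Reasoning

  /≤/1*⇐ : ∀ i k r n .{{_ : NonZero n}} → i ℤ.* ↧ r ℤ.≤ k ℤ.* ↥ r ℤ.* + n → (i ℚ./ n) ℚ.≤ (k ℚ./ 1) ℚ.* r
  /≤/1*⇐ i k r@record{} (suc n-1) le = ℚ.toℚᵘ-cancel-≤ (begin
    toℚᵘ (i ℚ./ suc n-1)                      ≃⟨ ℚ.toℚᵘ-fromℚᵘ (mkℚᵘ i n-1) ⟩
    mkℚᵘ i n-1                                ≤⟨ *≤* le ⟩
    mkℚᵘ (k ℤ.* ↥ r) (ℚ.denominator-1 r)      ≃⟨ /1-*-≃ k r ⟨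
    toℚᵘ ((k ℚ./ 1) ℚ.* r)                    ∎)
    where open ℚᵘ.≤-Reasoning

  /≤/1 : ∀ s m n .{{_ : NonZero n}} → s ≤ m * n → (+ s ℚ./ n) ℚ.≤ + m ℚ./ 1
  /≤/1 s m n le = subst ((+ s ℚ./ n) ℚ.≤_) (ℚ.*-identityʳ (+ m ℚ./ 1)) (/≤/1*⇐ (+ s) (+ m) ℚ.1ℚ n
    (subst₂ ℤ._≤_ (sym (ℤ.*-identityʳ (+ s)))
      (trans (ℤ.pos-* m n) (cong (ℤ._* + n) (sym (ℤ.*-identityʳ (+ m))))) (ℤ.+≤+ le)))

  /-distrib-+ : ∀ s t n .{{_ : NonZero n}} → + (s + t) ℚ./ n ≡ (+ s ℚ./ n) ℚ.+ (+ t ℚ./ n)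
  /-distrib-+ s t (suc n-1) = ℚ.toℚᵘ-injective (begin
    toℚᵘ (+ (s + t) ℚ./ n)                  ≈⟨ ℚ.toℚᵘ-fromℚᵘ (mkℚᵘ (+ (s + t)) n-1) ⟩
    mkℚᵘ (+ (s + t)) n-1                    ≈⟨ *≡* (trans (cong₂ ℤ._*_ (ℤ.pos-+ s t) (ℤ.pos-* n n))
                                                 (lemma (+ s) (+ t) (+ n))) ⟩
    mkℚᵘ (+ s) n-1 ℚᵘ.+ mkℚᵘ (+ t) n-1
      ≈⟨ ℚᵘ.+-cong (ℚ.toℚᵘ-fromℚᵘ (mkℚᵘ (+ s) n-1)) (ℚ.toℚᵘ-fromℚᵘ (mkℚᵘ (+ t) n-1)) ⟨
    toℚᵘ (+ s ℚ./ n) ℚᵘ.+ toℚᵘ (+ t ℚ./ n)  ≈⟨ ℚ.toℚᵘ-homo-+ (+ s ℚ./ n) (+ t ℚ./ n) ⟨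
    toℚᵘ ((+ s ℚ./ n) ℚ.+ (+ t ℚ./ n))      ∎)
    where
    open SetoidReasoning ℚᵘ.≃-setoid
    n = suc n-1
    lemma : ∀ s t n → (s ℤ.+ t) ℤ.* (n ℤ.* n) ≡ (s ℤ.* n ℤ.+ t ℤ.* n) ℤ.* n
    lemma s t n = trans (sym (ℤ.*-assoc (s ℤ.+ t) n n)) (cong (ℤ._* n) (ℤ.*-distribʳ-+ n s t))

  -- With `d` the denominator of `x`, the hypothesis on `b ^ M` is raised to the power `d`. For an
  -- expectation it therefore suffices to find an integer bound `M`.
  ≤·log-intro : ∀ x M b n c .{{_ : NonZero b}} .{{_ : NonZero n}} →
    x ℚ.≤ + M ℚ./ 1 → b ^ M ≤ n ^ c → x ≤ c ·log[ b ] n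
  ≤·log-intro x@(mkℚ (+ p) d-1 _) M b n c x≤M bᴹ≤nᶜ = begin
    b ^ p          ≤⟨ ^-monoʳ-≤ b (ℤ.drop‿+≤+ (subst (+ p ℤ.≤_) (sym (ℤ.pos-* M d)) (≤⇒↥≤*↧ x (+ M) x≤M))) ⟩
    b ^ (M * d)    ≡⟨ ^-*-assoc b M d ⟨
    (b ^ M) ^ d    ≤⟨ ^-monoˡ-≤ d bᴹ≤nᶜ ⟩
    (n ^ c) ^ d    ≡⟨ ^-*-assoc n c d ⟩
    n ^ (c * d)    ∎
    where
    open ≤-Reasoning
    d = suc d-1
  -- For negative `x` it is enough that both powers are positive.
  ≤·log-intro x@(mkℚ -[1+ p ] _ _) M b n c _ _ =
    *-mono-≤ (m^n>0 n (c * ↧ₙ x)) (m^n>0 b (suc p))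

  /1-*-/1 : ∀ k m r → (k ℚ./ 1) ℚ.* ((m ℚ./ 1) ℚ.* r) ≡ (k ℤ.* m ℚ./ 1) ℚ.* r
  /1-*-/1 k m r = trans (sym (ℚ.*-assoc (k ℚ./ 1) (m ℚ./ 1) r))
    (cong (ℚ._* r) (ℚ.toℚᵘ-injective (begin
      toℚᵘ ((k ℚ./ 1) ℚ.* (m ℚ./ 1))        ≈⟨ ℚ.toℚᵘ-homo-* (k ℚ./ 1) (m ℚ./ 1) ⟩
      toℚᵘ (k ℚ./ 1) ℚᵘ.* toℚᵘ (m ℚ./ 1)    ≈⟨ ℚᵘ.*-cong (ℚ.toℚᵘ-fromℚᵘ (mkℚᵘ k 0)) (ℚ.toℚᵘ-fromℚᵘ (mkℚᵘ m 0)) ⟩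
      mkℚᵘ (k ℤ.* m) 0                      ≈⟨ ℚ.toℚᵘ-fromℚᵘ (mkℚᵘ (k ℤ.* m) 0) ⟨
      toℚᵘ (k ℤ.* m ℚ./ 1)                  ∎)))
    where open SetoidReasoning ℚᵘ.≃-setoid

  i-j≤k⇒i≤j+k : ∀ i j k → + i ℤ.- + j ℤ.≤ + k → i ≤ j + k
  i-j≤k⇒i≤j+k i j k le = ℤ.drop‿+≤+ (begin
    + i                        ≡⟨ ℤ.+-identityʳ (+ i) ⟨
    + i ℤ.+ + 0                ≡⟨ cong (λ z → + i ℤ.+ z) (ℤ.+-inverseˡ (+ j)) ⟨
    + i ℤ.+ (ℤ.- + j ℤ.+ + j)  ≡⟨ ℤ.+-assoc (+ i) (ℤ.- + j) (+ j) ⟨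
    + i ℤ.- + j ℤ.+ + j        ≤⟨ ℤ.+-monoˡ-≤ (+ j) le ⟩
    + k ℤ.+ + j                ≡⟨ ℤ.+-comm (+ k) (+ j) ⟩
    + (j + k)                  ∎)
    where open ℤ.≤-Reasoning

  i≤j+k⇒i-j≤k : ∀ i j k → i ≤ j + k → + i ℤ.- + j ℤ.≤ + k
  i≤j+k⇒i-j≤k i j k le = begin
    + i ℤ.- + j                ≤⟨ ℤ.+-monoˡ-≤ (ℤ.- + j) (ℤ.+≤+ le) ⟩
    + (j + k) ℤ.- + j          ≡⟨ cong (λ z → z ℤ.- + j) (ℤ.+-comm (+ j) (+ k)) ⟩
    + k ℤ.+ + j ℤ.- + j        ≡⟨ ℤ.+-assoc (+ k) (+ j) (ℤ.- + j) ⟩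
    + k ℤ.+ (+ j ℤ.- + j)      ≡⟨ cong (λ z → + k ℤ.+ z) (ℤ.+-inverseʳ (+ j)) ⟩
    + k ℤ.+ + 0                ≡⟨ ℤ.+-identityʳ (+ k) ⟩
    + k                        ∎
    where open ℤ.≤-Reasoning

  -- The formula of `δ` with `α + 1` and the ceiling as variables, so that its properties can be
  -- proved apart from the division by `ρ`.
  clamp : ℕ → ℤ → ℕ
  clamp a c = ∣ + a ℤ.⊓ (+ 1 ℤ.⊔ c) ∣

  +clamp : ∀ a c → + clamp a c ≡ + a ℤ.⊓ (+ 1 ℤ.⊔ c)
  +clamp a c = ℤ.0≤i⇒+∣i∣≡i (ℤ.⊓-glb (ℤ.+≤+ z≤n) (ℤ.≤-trans (ℤ.+≤+ z≤n) (ℤ.i≤i⊔j (+ 1) c)))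

  clamp≤ : ∀ a c → clamp a c ≤ a
  clamp≤ a c = ℤ.drop‿+≤+ (subst (ℤ._≤ + a) (sym (+clamp a c)) (ℤ.i⊓j≤i (+ a) _))

  1≤clamp : ∀ a c → 1 ≤ a → 1 ≤ clamp a c
  1≤clamp a c 1≤a = ℤ.drop‿+≤+ (subst (+ 1 ℤ.≤_) (sym (+clamp a c))
    (ℤ.⊓-glb (ℤ.+≤+ 1≤a) (ℤ.i≤i⊔j (+ 1) c)))

  clamp<⇒≤clamp : ∀ a c → clamp a c < a → c ℤ.≤ + clamp a c
  clamp<⇒≤clamp a c lt with ℤ.⊓-sel (+ a) (+ 1 ℤ.⊔ c)
  ... | inj₁ eq = contradiction (ℤ.+-injective (trans (+clamp a c) eq)) (<⇒≢ lt)
  ... | inj₂ eq = ℤ.≤-trans (ℤ.i≤j⊔i (+ 1) c) (ℤ.≤-reflexive (sym (trans (+clamp a c) eq)))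

  ≤⇒clamp≤ : ∀ a b c → 1 ≤ b → c ℤ.≤ + b → clamp a c ≤ b
  ≤⇒clamp≤ a b c 1≤b c≤b = ℤ.drop‿+≤+ (subst (ℤ._≤ + b) (sym (+clamp a c))
    (ℤ.≤-trans (ℤ.i⊓j≤j (+ a) _) (ℤ.⊔-lub (ℤ.+≤+ 1≤b) c≤b)))

  module ParameterProperties (P : Parameters) where

    open Parameters P

    instance
      _ = ℚ.pos⇒nonZero ρ {{ρ-positive}}
      _ = ρ-positive
      _ = ℚ.pos⇒nonZero ε

    -- In lowest terms `1/ε` is `u / v`, so `ρ = 108 α u / v`. Inequalities about `ρ` are multiplied
    -- by `v` to become inequalities between natural numbers.
    u v : ℕ
    u = ∣ ↥ 1/ε ∣
    v = ↧ₙ 1/ε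

    1/ε-positive : ℚ.Positive 1/ε
    1/ε-positive = ℚ.1/pos⇒pos ε

    ↥1/ε≡u : ↥ 1/ε ≡ + u
    ↥1/ε≡u = go 1/ε 1/ε-positive
      where
      go : ∀ p → ℚ.Positive p → ↥ p ≡ + ∣ ↥ p ∣
      go (mkℚ (+ _) _ _) _ = refl

    fraction : ℕ → ℚ
    fraction s = ((+ s ℤ.- + α) ℚ./ 1) ℚ.÷ ρ

    fraction*ρ : ∀ s → fraction s ℚ.* ρ ≡ (+ s ℤ.- + α) ℚ./ 1
    fraction*ρ s = trans (ℚ.*-assoc x (ℚ.1/ ρ) ρ)
      (trans (cong (x ℚ.*_) (ℚ.*-inverseˡ ρ)) (ℚ.*-identityʳ x))
      where x = (+ s ℤ.- + α) ℚ./ 1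

    k*ρ : ∀ k → (+ k ℚ./ 1) ℚ.* ρ ≡ (+ (k * (108 * α)) ℚ./ 1) ℚ.* 1/ε
    k*ρ k = trans (/1-*-/1 (+ k) (+ (108 * α)) 1/ε)
      (cong (λ z → (z ℚ./ 1) ℚ.* 1/ε) (sym (ℤ.pos-* k (108 * α))))

    [s-α]*v : ∀ s → (+ s ℤ.- + α) ℤ.* + v ≡ + (s * v) ℤ.- + (α * v)
    [s-α]*v s = begin
      (+ s ℤ.- + α) ℤ.* + v              ≡⟨ ℤ.*-distribʳ-+ (+ v) (+ s) (ℤ.- + α) ⟩
      + s ℤ.* + v ℤ.+ ℤ.- + α ℤ.* + v    ≡⟨ cong (λ z → + s ℤ.* + v ℤ.+ z) (ℤ.neg-distribˡ-* (+ α) (+ v)) ⟨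
      + s ℤ.* + v ℤ.- + α ℤ.* + v        ≡⟨ cong₂ ℤ._-_ (ℤ.pos-* s v) (ℤ.pos-* α v) ⟨
      + (s * v) ℤ.- + (α * v)            ∎
      where open ≡-Reasoning

    k*↥1/ε : ∀ k → + k ℤ.* ↥ 1/ε ℤ.* + 1 ≡ + (k * u)
    k*↥1/ε k = trans (ℤ.*-identityʳ (+ k ℤ.* ↥ 1/ε))
      (trans (cong (λ z → + k ℤ.* z) ↥1/ε≡u) (sym (ℤ.pos-* k u)))

    -- The conclusion is `s ≤ α + k ρ` multiplied by `v`.
    fraction≤⇒ : ∀ s k → fraction s ℚ.≤ + k ℚ./ 1 → s * v ≤ α * v + k * (108 * α) * u
    fraction≤⇒ s k le = i-j≤k⇒i≤j+k (s * v) (α * v) (k * (108 * α) * u)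
      (subst₂ ℤ._≤_ ([s-α]*v s) (k*↥1/ε (k * (108 * α)))
        (/≤/1*⇒ (+ s ℤ.- + α) (+ (k * (108 * α))) 1/ε 1
          (subst₂ ℚ._≤_ (fraction*ρ s) (k*ρ k)
            (ℚ.*-monoʳ-≤-nonNeg ρ {{ℚ.pos⇒nonNeg ρ}} le))))

    fraction≤⇐ : ∀ s k → s * v ≤ α * v + k * (108 * α) * u → fraction s ℚ.≤ + k ℚ./ 1
    fraction≤⇐ s k le = ℚ.*-cancelʳ-≤-pos ρ
      (subst₂ ℚ._≤_ (sym (fraction*ρ s)) (sym (k*ρ k))
        (/≤/1*⇐ (+ s ℤ.- + α) (+ (k * (108 * α))) 1/ε 1
          (subst₂ ℤ._≤_ (sym ([s-α]*v s)) (sym (k*↥1/ε (k * (108 * α))))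
            (i≤j+k⇒i-j≤k (s * v) (α * v) (k * (108 * α) * u) le))))

    -- This carries the hypothesis `ε≤½`; it amounts to `ρ ≥ 216 α`.
    2v≤u : 2 * v ≤ u
    2v≤u = go 1/ε 1/ε-positive two≤
      where
      two≤ : + 2 ℚ./ 1 ℚ.≤ 1/ε
      two≤ = ℚ.*-cancelʳ-≤-pos ε (subst₂ ℚ._≤_ refl (sym (ℚ.*-inverseˡ ε))
        (ℚ.*-monoˡ-≤-nonNeg (+ 2 ℚ./ 1) ε≤½))
      go : ∀ p → ℚ.Positive p → + 2 ℚ./ 1 ℚ.≤ p → 2 * ↧ₙ p ≤ ∣ ↥ p ∣
      go (mkℚ (+ n) d-1 _) _ (ℚ.*≤* le) = subst (2 * suc d-1 ≤_) (*-identityʳ n)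
        (ℤ.drop‿+≤+ (subst₂ ℤ._≤_ (sym (ℤ.pos-* 2 (suc d-1))) (sym (ℤ.pos-* n 1)) le))

    -- Opaque because unfolding δ during type checking produces huge terms.

    opaque
      fanOut : ℕ → ℕ
      fanOut = δ

      fanOut≡δ : ∀ s → fanOut s ≡ δ s
      fanOut≡δ s = refl

      fanOut≤α+1 : ∀ s → fanOut s ≤ α + 1
      fanOut≤α+1 s = clamp≤ (α + 1) (ceiling (fraction s))

      1≤fanOut : ∀ s → 1 ≤ fanOut s
      1≤fanOut s = 1≤clamp (α + 1) (ceiling (fraction s)) (m≤n+m 1 α)

      -- Strictly below the cap `α + 1` the fan-out is at least the ceiling, so `s ≤ α + δ ρ`.
      secondary⇒small : ∀ s → fanOut s < α + 1 → s * v ≤ α * v + fanOut s * (108 * α) * u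
      secondary⇒small s δ<α+1 = fraction≤⇒ s (δ s) (ceiling≤⇒≤ (fraction s) (+ δ s)
        (clamp<⇒≤clamp (α + 1) (ceiling (fraction s)) δ<α+1))

      -- With `s ≤ α + α ρ` the ceiling would be at most `α`, and so would the fan-out. Hence `s`
      -- exceeds `α + α ρ`, where `ρ ≥ 216 α`.
      primary⇒large : ∀ s → fanOut s ≡ α + 1 → 216 * (α * α) + α < s
      primary⇒large s δ≡α+1 = *-cancelʳ-< v _ _ (begin-strict
        (216 * (α * α) + α) * v            ≡⟨ lemma 108 α v ⟩
        α * v + α * (108 * α) * (2 * v)    ≤⟨ +-monoʳ-≤ (α * v) (*-monoʳ-≤ (α * (108 * α)) 2v≤u) ⟩
        α * v + α * (108 * α) * u          <⟨ ≰⇒> (λ le → <⇒≱ (m<m+n α (s≤s z≤n)) (α+1≤α le)) ⟩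
        s * v                              ∎)
        where
        open ≤-Reasoning
        lemma : ∀ c a v → (c * 2 * (a * a) + a) * v ≡ a * v + a * (c * a) * (2 * v)
        lemma = solve-∀
        α+1≤α : s * v ≤ α * v + α * (108 * α) * u → α + 1 ≤ α
        α+1≤α le = subst (_≤ α) δ≡α+1 (≤⇒clamp≤ (α + 1) α (ceiling (fraction s)) (>-nonZero⁻¹ α)
          (≤⇒ceiling≤ (fraction s) (+ α) (fraction≤⇐ s α le)))

-- The search path

module SearchPath {k ℓ₁ ℓ₂ : Level} (O : StrictTotalOrder k ℓ₁ ℓ₂) (P : Parameters)
  (q : StrictTotalOrder.Carrier O) where

  open Parameters P
  open ParameterProperties P using (fanOut; fanOut≡δ)
  open RBST O P
  open Block
  open StrictTotalOrder O using (_≈_; module Eq)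
    renaming (Carrier to Key; _<_ to _<ᵏ_; _<?_ to _<ᵏ?_; trans to <ᵏ-trans; asym to <ᵏ-asym;
              compare to <ᵏ-compare; <-respʳ-≈ to <ᵏ-respʳ-≈; <-respˡ-≈ to <ᵏ-respˡ-≈)
  open import Data.Tree.AVL.Key O using ([_]; [_]ᴿ; _<⁺_; trans⁺)
  open DecTotalOrder (StrictTotalOrderProperties.decTotalOrder O) using (totalOrder)
    renaming (_≤_ to _≤ᵏ_)
  open Sort (StrictTotalOrderProperties.decTotalOrder O) using (sort; sort-↭; sort-↗)

  sort-pairwise : ∀ xs → AllPairs _≤ᵏ_ (sort xs)
  sort-pairwise xs = Sorted⇒AllPairs totalOrder (sort-↗ xs)

  <-≤-transᵏ : ∀ {x y z} → x <ᵏ y → y ≤ᵏ z → x <ᵏ z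
  <-≤-transᵏ x<y (inj₁ y<z) = <ᵏ-trans x<y y<z
  <-≤-transᵏ x<y (inj₂ y≈z) = <ᵏ-respʳ-≈ y≈z x<y

  ≤-<-transᵏ : ∀ {x y z} → x ≤ᵏ y → y <ᵏ z → x <ᵏ z
  ≤-<-transᵏ (inj₁ x<y) y<z = <ᵏ-trans x<y y<z
  ≤-<-transᵏ (inj₂ x≈y) y<z = <ᵏ-respˡ-≈ (Eq.sym x≈y) y<z

  drop-[] : ∀ {x y} → [ x ] <⁺ [ y ] → x <ᵏ y
  drop-[] = Extrema.[<]-injective _<ᵏ_

  -- Defined for all intervals and lists, whether or not they enclose `q`, so that the sums over
  -- orderings carry no side condition.
  gap : Interval → List Key → Interval
  gap (l , r) []       = l , r
  gap (l , r) (x ∷ xs) with q <ᵏ? x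
  ... | yes _ = l , [ x ]
  ... | no  _ = gap ([ x ] , r) xs

  gap-∋q : ∀ {l r} xs → q ∈ᴵ (l , r) → All (λ x → ¬ (q ≈ x)) xs → q ∈ᴵ gap (l , r) xs
  gap-∋q []       q∈        _           = q∈
  gap-∋q (x ∷ xs) (l<q , q<r) (q≉x ∷ q≉xs) with q <ᵏ? x
  ... | yes q<x = l<q , [ q<x ]ᴿ
  ... | no  q≮x with <ᵏ-compare q x
  ...   | tri< q<x _ _ = contradiction q<x q≮x
  ...   | tri≈ _ q≈x _ = contradiction q≈x q≉x
  ...   | tri> _ _ x<q = gap-∋q xs ([ x<q ]ᴿ , q<r) q≉xs

  gap-lower : ∀ {x y r} xs → AllPairs _≤ᵏ_ (x ∷ xs) → y ∈ᴵ gap ([ x ] , r) xs → x <ᵏ y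
  gap-lower []        _                             (x<y , _) = drop-[] x<y
  gap-lower (x′ ∷ xs) ((x≤x′ ∷ x≤xs) ∷ x′≤xs ∷ xs↗) y∈ with q <ᵏ? x′
  ... | yes _ = drop-[] (proj₁ y∈)
  ... | no  _ = ≤-<-transᵏ x≤x′ (gap-lower xs (x′≤xs ∷ xs↗) y∈)

  SameSide : Key → Key → Set ℓ₂
  SameSide y z = (z <ᵏ y × ¬ (q <ᵏ z)) ⊎ (y <ᵏ z × q <ᵏ z)

  gap-sameSide : ∀ {l r y z} xs → AllPairs _≤ᵏ_ xs → y ∈ᴵ gap (l , r) xs → z ∈ xs → SameSide y z
  gap-sameSide (x ∷ xs) (x≤xs ∷ xs↗) y∈ z∈ with q <ᵏ? x
  gap-sameSide (x ∷ xs) (x≤xs ∷ xs↗) y∈ (here refl) | yes q<x = inj₂ (drop-[] (proj₂ y∈) , q<x)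
  gap-sameSide (x ∷ xs) (x≤xs ∷ xs↗) y∈ (there z∈)  | yes q<x =
    inj₂ (<-≤-transᵏ (drop-[] (proj₂ y∈)) (All.lookup x≤xs z∈) , <-≤-transᵏ q<x (All.lookup x≤xs z∈))
  gap-sameSide (x ∷ xs) (x≤xs ∷ xs↗) y∈ (here refl) | no q≮x = inj₁ (gap-lower xs (x≤xs ∷ xs↗) y∈ , q≮x)
  gap-sameSide (x ∷ xs) (x≤xs ∷ xs↗) y∈ (there z∈)  | no q≮x = gap-sameSide xs xs↗ y∈ z∈

  -- The intervals before `gap` end at separators not above `q`, and those after it begin at
  -- separators above `q`; on all of these `f` vanishes.
  concatMap-gaps : ∀ {b} {B : Set b} (f : Interval → List B) → (∀ J → ¬ (q ∈ᴵ J) → f J ≡ []) →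
    ∀ {l r} xs → AllPairs _≤ᵏ_ xs → concatMap f (gaps (l , r) xs) ≡ f (gap (l , r) xs)
  concatMap-gaps f f≡[] {l} {r} []       _ = List.++-identityʳ (f (l , r))
  concatMap-gaps f f≡[] {l} {r} (x ∷ xs) (x≤xs ∷ xs↗) with q <ᵏ? x
  ... | yes q<x = trans (cong (f (l , [ x ]) ++_) (above xs q<x x≤xs xs↗)) (List.++-identityʳ _)
    where
    above : ∀ {x r} xs → q <ᵏ x → All (x ≤ᵏ_) xs → AllPairs _≤ᵏ_ xs →
            concatMap f (gaps ([ x ] , r) xs) ≡ []
    above []        q<x _            _             =
      cong (_++ []) (f≡[] _ λ q∈ → <ᵏ-asym q<x (drop-[] (proj₁ q∈)))
    above (x′ ∷ xs) q<x (x≤x′ ∷ _) (x′≤xs ∷ xs↗) = cong₂ _++_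
      (f≡[] _ λ q∈ → <ᵏ-asym q<x (drop-[] (proj₁ q∈)))
      (above xs (<-≤-transᵏ q<x x≤x′) x′≤xs xs↗)
  ... | no q≮x = trans
    (cong (_++ concatMap f (gaps ([ x ] , r) xs)) (f≡[] (l , [ x ]) (q≮x ∘ drop-[] ∘ proj₂)))
    (concatMap-gaps f f≡[] xs xs↗)

  -- The relation `l ≤ l′` is expressed by its consequence for `q`, which is all that the lower
  -- endpoints have to provide.
  gaps-⊆ : ∀ {l l′ r} xs → (l′ <⁺ [ q ] → l <⁺ [ q ]) → All (_∈ᴵ (l , r)) xs →
           All (λ J → q ∈ᴵ J → q ∈ᴵ (l , r)) (gaps (l′ , r) xs)
  gaps-⊆ []       l≤l′ _ = (λ (l′<q , q<r) → l≤l′ l′<q , q<r) ∷ []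
  gaps-⊆ {l} (x ∷ xs) l≤l′ ((l<x , x<r) ∷ xs∈) =
    (λ (l′<q , q<x) → l≤l′ l′<q , trans⁺ [ q ] q<x x<r) ∷ gaps-⊆ xs (trans⁺ l l<x) xs∈

  concatMap-[] : ∀ {a b} {A : Set a} {B : Set b} {f : A → List B} {xs} →
    All (λ x → f x ≡ []) xs → concatMap f xs ≡ []
  concatMap-[] []             = refl
  concatMap-[] (eq ∷ eqs) = cong₂ _++_ eq (concatMap-[] eqs)

  onPath? : Decidable (λ b → q ∈ᴵ interval b)
  onPath? b = q ∈ᴵ? interval b

  filter-blocks* : ∀ (t : Interval → Maybe Tree) Js →
    filter onPath? (blocks* (mapMaybe t Js)) ≡ concatMap (λ J → filter onPath? (maybe′ blocks [] (t J))) Js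
  filter-blocks* t []       = refl
  filter-blocks* t (J ∷ Js) with t J
  ... | nothing = filter-blocks* t Js
  ... | just t₁ = trans (List.filter-++ onPath? (blocks t₁) _)
                        (cong (filter onPath? (blocks t₁) ++_) (filter-blocks* t Js))

  path : ∀ m Y → .(length Y ≤ m) → Interval → List Block
  path m Y Y≤m I = filter onPath? (maybe′ blocks [] (build m Y Y≤m I))

  -- The keys lie in `I`, hence so do the separators, and a child interval containing `q` would put
  -- `q` into `I`. This is what makes the blocks whose interval contains `q` a single path.
  path-outside : ∀ m Y .(Y≤m : length Y ≤ m) {I} → All (_∈ᴵ I) Y → ¬ (q ∈ᴵ I) → path m Y Y≤m I ≡ []
  path-outside m       []         _   _  _  = refl
  path-outside zero    (_ ∷ _)    ()
  path-outside (suc m) Y@(_ ∷ _) Y≤m {I} Y∈ q∉ with length Y ≤? α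
  ... | yes _ = List.filter-reject onPath? q∉
  ... | no  _ = trans (List.filter-reject onPath? q∉)
    (trans (filter-blocks* _ (gaps I (sort ys)))
      (concatMap-[] (All.map (λ {J} J⊆ → path-outside m _ _ (All.all-filter (_∈ᴵ? J) (drop α Y)) (q∉ ∘ J⊆))
        (gaps-⊆ (sort ys) (λ l<q → l<q) (All-resp-↭ (↭-sym (sort-↭ ys)) (All.take⁺ _ Y∈))))))
    where ys = take (δ (length Y) ∸ 1) Y

  section : Interval → List Key → Interval
  section I ys = gap I (sort ys)

  childInterval : Interval → List Key → Interval
  childInterval I Y = section I (take (fanOut (length Y) ∸ 1) Y)

  childKeys : Interval → List Key → List Key
  childKeys I Y = filter (_∈ᴵ? childInterval I Y) (drop α Y)

  -- Only the subtree sizes are recorded, as they decide which blocks are primary. The first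
  -- argument is mere fuel; running out of it only shortens the list, which is harmless for upper
  -- bounds. A leaf needs no clause of its own, since `drop α Y` is empty there.
  route : ℕ → Interval → List Key → List ℕ
  route _       _ []        = []
  route zero    _ (_ ∷ _)   = []
  route (suc m) I Y@(_ ∷ _) = length Y ∷ route m (childInterval I Y) (childKeys I Y)

  path-sizes : ∀ m Y .(Y≤m : length Y ≤ m) I → q ∈ᴵ I → All (λ x → ¬ (q ≈ x)) Y →
    map size (path m Y Y≤m I) ≡ route m I Y
  path-sizes m       []         _   _ _  _ = refl
  path-sizes zero    (_ ∷ _)    ()
  path-sizes (suc m) Y@(_ ∷ _) Y≤m I q∈ q≉ with length Y ≤? α
  ... | yes Y≤α = trans (cong (map size) (List.filter-accept onPath? q∈))
    (cong (length Y ∷_) (sym (cong (λ zs → route m (childInterval I Y) (filter (_∈ᴵ? childInterval I Y) zs))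
                                    (List.drop-all α Y Y≤α))))
  ... | no  _   = trans (cong (map size) (List.filter-accept onPath? q∈))
    (cong (length Y ∷_) (trans (cong (map size) (trans (filter-blocks* _ (gaps I (sort ys)))
      (concatMap-gaps _ (λ J q∉ → path-outside m _ _ (All.all-filter (_∈ᴵ? J) (drop α Y)) q∉)
        (sort ys) (sort-pairwise ys))))
      (trans (path-sizes m _ _ (section I ys) (gap-∋q (sort ys) q∈ (All-resp-↭ (↭-sym (sort-↭ ys)) (All.take⁺ _ q≉)))
               (All.filter⁺ (_∈ᴵ? section I ys) (All.drop⁺ α q≉)))
             (cong (λ d → let J = section I (take (d ∸ 1) Y) in route m J (filter (_∈ᴵ? J) (drop α Y)))
                   (sym (fanOut≡δ (length Y)))))))
    where ys = take (δ (length Y) ∸ 1) Y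

  -- Among any set of keys, only the predecessor and the successor of q
  -- lie in the section of q cut out by the other keys.

  section-neighbours : ∀ I ys → ∑sel (λ y ys′ → 𝟙 (y ∈ᴵ? section I ys′)) ys ≤ 2
  section-neighbours I ys = begin
    ∑sel (λ y ys′ → 𝟙 (y ∈ᴵ? section I ys′)) ys
      ≤⟨ ∑sel-mono ys (λ y ys′ _ → pointwise y ys′) ⟩
    ∑sel (λ y ys′ → 𝟙 (all? (y ≻ˡ?_) ys′) + 𝟙 (all? (y ≻ʳ?_) ys′)) ys
      ≡⟨ ∑sel-+ (λ y ys′ → 𝟙 (all? (y ≻ˡ?_) ys′)) _ ys ⟩
    ∑sel (λ y ys′ → 𝟙 (all? (y ≻ˡ?_) ys′)) ys + ∑sel (λ y ys′ → 𝟙 (all? (y ≻ʳ?_) ys′)) ys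
      ≤⟨ +-mono-≤ (∑sel-dominating _≻ˡ?_ ≻ˡ-asym ys) (∑sel-dominating _≻ʳ?_ ≻ʳ-asym ys) ⟩
    2 ∎
    where
    open ≤-Reasoning
    -- `y ≻ˡ z` says that `y` beats `z` as predecessor of `q`: it is not above `q`, while `z` is
    -- smaller or beyond `q`. Likewise `≻ʳ` compares candidates for the successor.
    _≻ˡ_ _≻ʳ_ : Key → Key → Set ℓ₂
    y ≻ˡ z = ¬ (q <ᵏ y) × (z <ᵏ y ⊎ q <ᵏ z)
    y ≻ʳ z = q <ᵏ y × (y <ᵏ z ⊎ ¬ (q <ᵏ z))

    _≻ˡ?_ : ∀ y z → Dec (y ≻ˡ z)
    y ≻ˡ? z = ¬? (q <ᵏ? y) ×-dec ((z <ᵏ? y) ⊎-dec (q <ᵏ? z))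

    _≻ʳ?_ : ∀ y z → Dec (y ≻ʳ z)
    y ≻ʳ? z = (q <ᵏ? y) ×-dec ((y <ᵏ? z) ⊎-dec ¬? (q <ᵏ? z))

    ≻ˡ-asym : ∀ {y z} → y ≻ˡ z → ¬ (z ≻ˡ y)
    ≻ˡ-asym (q≮y , inj₂ q<z) (q≮z , _)        = q≮z q<z
    ≻ˡ-asym (q≮y , inj₁ _)   (q≮z , inj₂ q<y) = q≮y q<y
    ≻ˡ-asym (q≮y , inj₁ z<y) (q≮z , inj₁ y<z) = <ᵏ-asym z<y y<z

    ≻ʳ-asym : ∀ {y z} → y ≻ʳ z → ¬ (z ≻ʳ y)
    ≻ʳ-asym (q<y , inj₂ q≮z) (q<z , _)        = q≮z q<z
    ≻ʳ-asym (q<y , inj₁ _)   (q<z , inj₂ q≮y) = q≮y q<y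
    ≻ʳ-asym (q<y , inj₁ y<z) (q<z , inj₁ z<y) = <ᵏ-asym z<y y<z

    pointwise : ∀ y ys′ → 𝟙 (y ∈ᴵ? section I ys′) ≤ 𝟙 (all? (y ≻ˡ?_) ys′) + 𝟙 (all? (y ≻ʳ?_) ys′)
    pointwise y ys′ = 𝟙≤ (y ∈ᴵ? section I ys′) λ y∈ → bySide y∈
      where
      bySide : y ∈ᴵ section I ys′ → 1 ≤ 𝟙 (all? (y ≻ˡ?_) ys′) + 𝟙 (all? (y ≻ʳ?_) ys′)
      bySide y∈ = split (q <ᵏ? y)
        where
        sides : All (SameSide y) ys′
        sides = All.tabulate λ z∈ → gap-sameSide (sort ys′) (sort-pairwise ys′) y∈
                  (∈-resp-↭ (↭-sym (sort-↭ ys′)) z∈)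

        split : Dec (q <ᵏ y) → 1 ≤ 𝟙 (all? (y ≻ˡ?_) ys′) + 𝟙 (all? (y ≻ʳ?_) ys′)
        split (yes q<y) = ≤-trans (≤-reflexive (sym (𝟙-yes (all? (y ≻ʳ?_) ys′) (All.map right sides)))) (m≤n+m _ _)
          where
          right : ∀ {z} → SameSide y z → y ≻ʳ z
          right (inj₁ (_ , q≮z)) = q<y , inj₂ q≮z
          right (inj₂ (y<z , _)) = q<y , inj₁ y<z
        split (no q≮y) = ≤-trans (≤-reflexive (sym (𝟙-yes (all? (y ≻ˡ?_) ys′) (All.map left sides)))) (m≤m+n _ _)
          where
          left : ∀ {z} → SameSide y z → y ≻ˡ z
          left (inj₁ (z<y , _)) = q≮y , inj₁ z<y
          left (inj₂ (_ , q<z)) = q≮y , inj₂ q<z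

-- Expected numbers of blocks

module _ {a} {A : Set a} where

  take-++ : ∀ {j} {xs : List A} ys → length xs ≡ j → take j (xs ++ ys) ≡ xs
  take-++ {xs = []}     ys refl = refl
  take-++ {xs = x ∷ xs} ys refl = cong (x ∷_) (take-++ ys refl)

  take-++-≤ : ∀ j (xs : List A) ys → j ≤ length xs → take j (xs ++ ys) ≡ take j xs
  take-++-≤ zero    xs       ys _        = refl
  take-++-≤ (suc j) (x ∷ xs) ys (s≤s j≤) = cong (x ∷_) (take-++-≤ j xs ys j≤)

  drop-++ : ∀ {j} {xs : List A} ys → length xs ≡ j → drop j (xs ++ ys) ≡ ys
  drop-++ {xs = []}     ys refl = refl
  drop-++ {xs = x ∷ xs} ys refl = drop-++ {xs = xs} ys refl

  length-filter-drop : ∀ {p} {P : A → Set p} (P? : ∀ x → Dec (P x)) n xs →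
    length (filter P? (drop n xs)) ≤ length (filter P? xs)
  length-filter-drop P? zero    xs       = ≤-refl
  length-filter-drop P? (suc n) []       = z≤n
  length-filter-drop P? (suc n) (x ∷ xs) = ≤-trans (length-filter-drop P? n xs) (tail x)
    where
    tail : ∀ x → length (filter P? xs) ≤ length (filter P? (x ∷ xs))
    tail x with does (P? x)
    ... | true  = n≤1+n _
    ... | false = ≤-refl

module Bounds {k ℓ₁ ℓ₂ : Level} (O : StrictTotalOrder k ℓ₁ ℓ₂) (P : Parameters)
  (q : StrictTotalOrder.Carrier O) where

  open Parameters P using (α; α-nonZero)
  open ParameterProperties P
  open RBST O P using (Interval; _∈ᴵ?_)
  open SearchPath O P q using (section; childInterval; childKeys; route; section-neighbours)
  open StrictTotalOrder O using () renaming (Carrier to Key)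

  #prim #sec : List ℕ → ℕ
  #prim = length ∘ filter (λ s → fanOut s ≟ α + 1)
  #sec  = length ∘ filter (λ s → fanOut s <? α + 1)

  1≤α : 1 ≤ α
  1≤α = >-nonZero⁻¹ α

  route-zero : ∀ I Y → route 0 I Y ≡ []
  route-zero I []      = refl
  route-zero I (_ ∷ _) = refl

  route-suc : ∀ m I Y → 1 ≤ length Y →
    route (suc m) I Y ≡ length Y ∷ route m (childInterval I Y) (childKeys I Y)
  route-suc m I (_ ∷ _) _ = refl

  childKeys-small : ∀ I Y → length Y ≤ α → childKeys I Y ≡ []
  childKeys-small I Y Y≤α = cong (filter (_∈ᴵ? childInterval I Y)) (List.drop-all α Y Y≤α)

  route-small : ∀ m I Y → 1 ≤ length Y → length Y ≤ α → route (suc m) I Y ≡ length Y ∷ []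
  route-small m I Y 1≤Y Y≤α = trans (route-suc m I Y 1≤Y)
    (cong (λ zs → length Y ∷ route m (childInterval I Y) zs) (childKeys-small I Y Y≤α))

  ¬primary-small : ∀ s → s ≤ α → ¬ fanOut s ≡ α + 1
  ¬primary-small s s≤α prim = <⇒≱ (primary⇒large s prim) (≤-trans s≤α (m≤n+m α _))

  #prim-∷-yes : ∀ s ss → fanOut s ≡ α + 1 → #prim (s ∷ ss) ≡ suc (#prim ss)
  #prim-∷-yes s ss prim = cong length (List.filter-accept (λ s → fanOut s ≟ α + 1) prim)

  #prim-∷-no : ∀ s ss → ¬ fanOut s ≡ α + 1 → #prim (s ∷ ss) ≡ #prim ss
  #prim-∷-no s ss ¬prim = cong length (List.filter-reject (λ s → fanOut s ≟ α + 1) ¬prim)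

  #sec-∷-primary : ∀ s ss → fanOut s ≡ α + 1 → #sec (s ∷ ss) ≡ #sec ss
  #sec-∷-primary s ss prim = cong length (List.filter-reject (λ s → fanOut s <? α + 1) (λ sec → <⇒≢ sec prim))

  #sec-∷-secondary : ∀ s ss → fanOut s < α + 1 → #sec (s ∷ ss) ≡ suc (#sec ss)
  #sec-∷-secondary s ss sec = cong length (List.filter-accept (λ s → fanOut s <? α + 1) sec)

  #prim+#sec : ∀ ss → #prim ss + #sec ss ≡ length ss
  #prim+#sec []       = refl
  #prim+#sec (s ∷ ss) with fanOut s ≟ α + 1
  ... | yes eq = trans (cong₂ _+_ (#prim-∷-yes s ss eq) (#sec-∷-primary s ss eq)) (cong suc (#prim+#sec ss))
  ... | no neq = trans (cong₂ _+_ (#prim-∷-no s ss neq) (#sec-∷-secondary s ss (≤∧≢⇒< (fanOut≤α+1 s) neq)))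
    (trans (+-suc _ _) (cong suc (#prim+#sec ss)))

  #prim-small : ∀ m I Y → length Y ≤ α → #prim (route m I Y) ≡ 0
  #prim-small m       I []         _   = refl
  #prim-small zero    I (_ ∷ _)    _   = refl
  #prim-small (suc m) I Y@(_ ∷ _) Y≤α = trans (cong #prim (route-small m I Y (s≤s z≤n) Y≤α))
    (#prim-∷-no (length Y) [] (¬primary-small (length Y) Y≤α))

  length-route-small : ∀ m I Y → length Y ≤ α → length (route m I Y) ≤ 1
  length-route-small m       I []         _   = z≤n
  length-route-small zero    I (_ ∷ _)    _   = z≤n
  length-route-small (suc m) I Y@(_ ∷ _) Y≤α = ≤-reflexive (cong length (route-small m I Y (s≤s z≤n) Y≤α))

  -- The summand `α` on the right pays for the last block, which may hold fewer than `α` keys.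
  α*length-route≤ : ∀ m I Y → α * length (route m I Y) ≤ length Y + α
  α*length-route≤ m       I []         = ≤-trans (≤-reflexive (*-zeroʳ α)) z≤n
  α*length-route≤ zero    I (_ ∷ _)    = ≤-trans (≤-reflexive (*-zeroʳ α)) z≤n
  α*length-route≤ (suc m) I Y@(_ ∷ _) with ≤-total (length Y) α
  ... | inj₁ Y≤α = begin
    α * length (route (suc m) I Y) ≤⟨ *-monoʳ-≤ α (length-route-small (suc m) I Y Y≤α) ⟩
    α * 1                          ≡⟨ *-identityʳ α ⟩
    α                              ≤⟨ m≤n+m α (length Y) ⟩
    length Y + α                   ∎
    where open ≤-Reasoning
  ... | inj₂ α≤Y = begin
    α * suc (length (route m (childInterval I Y) (childKeys I Y)))
      ≡⟨ *-suc α _ ⟩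
    α + α * length (route m (childInterval I Y) (childKeys I Y))
      ≤⟨ +-monoʳ-≤ α (α*length-route≤ m _ (childKeys I Y)) ⟩
    α + (length (childKeys I Y) + α)
      ≤⟨ +-monoʳ-≤ α (+-monoˡ-≤ α (List.length-filter (_∈ᴵ? childInterval I Y) (drop α Y))) ⟩
    α + (length (drop α Y) + α)
      ≡⟨ cong (λ l → α + (l + α)) (List.length-drop α Y) ⟩
    α + (length Y ∸ α + α)
      ≡⟨ cong (α +_) (m∸n+n≡m α≤Y) ⟩
    α + length Y
      ≡⟨ +-comm α _ ⟩
    length Y + α ∎
    where open ≤-Reasoning

  -- A bound in terms of the section of q after the first α picks carries
  -- over from the subtree of that section.

  ∑ord-child : ∀ c (b : ℕ → ℕ) (h : Interval → List Key → ℕ) →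
    (∀ J ys → c * ∑ord (h J) ys ≤ b (length ys) * length ys !) →
    ∀ I xs → α ≤ length xs →
    c * ∑ord (λ Y → h (childInterval I Y) (childKeys I Y)) xs ≤
    ∑pick α (λ ys zs → b (length (filter (_∈ᴵ? section I (take (fanOut (length xs) ∸ 1) ys)) zs)) * length zs !) xs
  ∑ord-child c b h h≤ I xs α≤ = begin
    c * ∑ord H xs
      ≡⟨ cong (c *_) (∑ord-pick α H xs α≤) ⟩
    c * ∑pick α (λ ys → ∑ord (H ∘ (ys ++_))) xs
      ≡⟨ ∑pick-* α c _ xs ⟨
    ∑pick α (λ ys zs → c * ∑ord (H ∘ (ys ++_)) zs) xs
      ≤⟨ ∑pick-mono α xs step ⟩
    ∑pick α (λ ys zs → b (length (filter (_∈ᴵ? J ys) zs)) * length zs !) xs ∎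
    where
    open ≤-Reasoning
    H : List Key → ℕ
    H Y = h (childInterval I Y) (childKeys I Y)
    J : List Key → Interval
    J ys = section I (take (fanOut (length xs) ∸ 1) ys)

    childInterval-++ : ∀ ys ws → length ys ≡ α → α + length ws ≡ length xs →
      childInterval I (ys ++ ws) ≡ J ys
    childInterval-++ ys ws eq₁ eq₂ = cong (section I) (trans
      (cong (λ s → take (fanOut s ∸ 1) (ys ++ ws))
        (trans (List.length-++ ys) (trans (cong (_+ length ws) eq₁) eq₂)))
      -- There are at most `α` separators, so the `α` picks `ys` already contain them all.
      (take-++-≤ _ ys ws (≤-trans (∸-monoˡ-≤ 1 (fanOut≤α+1 (length xs)))
        (≤-reflexive (trans (m+n∸n≡m α 1) (sym eq₁))))))

    H-++ : ∀ ys ws → length ys ≡ α → α + length ws ≡ length xs →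
      H (ys ++ ws) ≡ h (J ys) (filter (_∈ᴵ? J ys) ws)
    H-++ ys ws eq₁ eq₂
      rewrite childInterval-++ ys ws eq₁ eq₂ | drop-++ {xs = ys} ws eq₁ = refl

    step : ∀ ys zs → length ys ≡ α → α + length zs ≡ length xs →
      c * ∑ord (H ∘ (ys ++_)) zs ≤ b (length (filter (_∈ᴵ? J ys) zs)) * length zs !
    step ys zs eq₁ eq₂ = begin
      c * ∑ord (H ∘ (ys ++_)) zs
        ≡⟨ cong (c *_) (∑ord-cong zs λ ws ws↭ →
             H-++ ys ws eq₁ (trans (cong (α +_) (↭-length ws↭)) eq₂)) ⟩
      c * ∑ord (h (J ys) ∘ filter (_∈ᴵ? J ys)) zs
        ≤⟨ ∑ord-filter-≤ (_∈ᴵ? J ys) c (b (length (filter (_∈ᴵ? J ys) zs))) (h (J ys)) zs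
             (h≤ (J ys) (filter (_∈ᴵ? J ys) zs)) ⟩
      b (length (filter (_∈ᴵ? J ys) zs)) * length zs ! ∎

  ∑pick-≤ : ∀ j c (f : List Key → List Key → ℕ) xs → (∀ ys zs → length zs ≤ length xs → f ys zs ≤ c) →
    ∑pick j (λ ys zs → f ys zs * length zs !) xs ≤ c * length xs !
  ∑pick-≤ j c f xs f≤c = begin
    ∑pick j (λ ys zs → f ys zs * length zs !) xs
      ≤⟨ ∑pick-mono j xs (λ ys zs _ eq → *-monoˡ-≤ (length zs !) (f≤c ys zs (m+n≤o⇒n≤o j (≤-reflexive eq)))) ⟩
    ∑pick j (λ _ zs → c * length zs !) xs
      ≡⟨ ∑pick-* j c (λ _ zs → length zs !) xs ⟩
    c * ∑pick j (λ _ zs → length zs !) xs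
      ≤⟨ *-monoʳ-≤ c (∑pick-! j xs) ⟩
    c * length xs ! ∎
    where open ≤-Reasoning

  -- The section is measured among all keys after the first `j`, including keys that the block
  -- stores without using them as separators. For a secondary block this is an upper bound on the
  -- keys passed down.
  ∑ord-section : ∀ I j xs → j ≤ length xs →
    suc j * ∑ord (λ Y → length (filter (_∈ᴵ? section I (take j Y)) (drop j Y))) xs ≤
    2 * (length xs * length xs !)
  ∑ord-section I j xs j≤ = begin
    suc j * ∑ord F xs
      ≡⟨ cong (suc j *_) (∑ord-pick j F xs j≤) ⟩
    suc j * ∑pick j (λ ys → ∑ord (F ∘ (ys ++_))) xs
      ≡⟨ cong (suc j *_) (∑pick-cong j xs λ ys zs eq _ → step ys zs eq) ⟩
    suc j * ∑pick j (λ ys zs → length (filter (_∈ᴵ? section I ys) zs) * length zs !) xs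
      ≤⟨ section-size _ (λ ys → _∈ᴵ? section I ys) (section-neighbours I) j xs ⟩
    2 * (length xs * length xs !) ∎
    where
    open ≤-Reasoning
    F : List Key → ℕ
    F Y = length (filter (_∈ᴵ? section I (take j Y)) (drop j Y))
    step : ∀ ys zs → length ys ≡ j →
      ∑ord (F ∘ (ys ++_)) zs ≡ length (filter (_∈ᴵ? section I ys) zs) * length zs !
    step ys zs eq = trans
      (∑ord-cong zs λ ws ws↭ → trans
        (cong₂ (λ ys ws → length (filter (_∈ᴵ? section I ys) ws)) (take-++ ws eq) (drop-++ {xs = ys} ws eq))
        (↭-length (filter-↭ (_∈ᴵ? section I ys) ws↭)))
      (∑ord-const _ zs)

  -- Each primary block shrinks the section of q by a factor 2 / (α + 1) in
  -- expectation, so about s (2 / (α + 1)) ^ K / (72 α²) primary blocks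
  -- remain after the first K.

  ∑ord-#prim∸ : 2 ≤ α → ∀ m I K xs →
    72 * (α * α) * (α + 1) ^ K * ∑ord (λ Y → #prim (route m I Y) ∸ K) xs ≤
    2 ^ K * length xs * length xs !
  ∑ord-#prim∸ 2≤α = go
    where
    open ≤-Reasoning
    c = 72 * (α * α)

    vanishing : ∀ K b (f : List Key → ℕ) xs →
      (∀ ys → length ys ≡ length xs → f ys ≡ 0) → c * (α + 1) ^ K * ∑ord f xs ≤ b
    vanishing K b f xs f≡0 = ≤-trans (≤-reflexive (trans
      (cong (c * (α + 1) ^ K *_) (trans (∑ord-cong xs λ ys ys↭ → f≡0 ys (↭-length ys↭)) (∑ord-const 0 xs)))
      (*-zeroʳ (c * (α + 1) ^ K)))) z≤n

    go : ∀ m I K xs → c * (α + 1) ^ K * ∑ord (λ Y → #prim (route m I Y) ∸ K) xs ≤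
      2 ^ K * length xs * length xs !
    go zero    I K xs = vanishing K _ _ xs λ ys _ →
      trans (cong (λ r → #prim r ∸ K) (route-zero I ys)) (0∸n≡0 K)
    go (suc m) I K xs with length xs ≤? α
    ... | yes xs≤α = vanishing K _ _ xs λ ys eq →
      trans (cong (_∸ K) (#prim-small (suc m) I ys (≤-trans (≤-reflexive eq) xs≤α))) (0∸n≡0 K)
    ... | no xs≰α = cases (fanOut n ≟ α + 1) K
      where
      n = length xs
      α<n : α < n
      α<n = ≰⇒> xs≰α
      α≤n = <⇒≤ α<n

      size : List Key → List Key → ℕ
      size ys zs = length (filter (_∈ᴵ? section I (take (fanOut n ∸ 1) ys)) zs)

      below : ℕ → List Key → ℕ
      below K Y = #prim (route m (childInterval I Y) (childKeys I Y)) ∸ K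

      below-bound : ∀ K → c * (α + 1) ^ K * ∑ord (below K) xs ≤
        2 ^ K * ∑pick α (λ ys zs → size ys zs * length zs !) xs
      below-bound K = begin
        c * (α + 1) ^ K * ∑ord (below K) xs
          ≤⟨ ∑ord-child (c * (α + 1) ^ K) (2 ^ K *_) (λ J Y → #prim (route m J Y) ∸ K) (λ J → go m J K) I xs α≤n ⟩
        ∑pick α (λ ys zs → 2 ^ K * size ys zs * length zs !) xs
          ≡⟨ ∑pick-cong α xs (λ ys zs _ _ → *-assoc (2 ^ K) (size ys zs) (length zs !)) ⟩
        ∑pick α (λ ys zs → 2 ^ K * (size ys zs * length zs !)) xs
          ≡⟨ ∑pick-* α (2 ^ K) (λ ys zs → size ys zs * length zs !) xs ⟩
        2 ^ K * ∑pick α (λ ys zs → size ys zs * length zs !) xs ∎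

      root : ∀ {Y} → Y ↭ xs → route (suc m) I Y ≡ n ∷ route m (childInterval I Y) (childKeys I Y)
      root {Y} Y↭ = trans (route-suc m I Y (≤-trans (≤-trans 1≤α α≤n) (≤-reflexive (sym (↭-length Y↭)))))
        (cong (_∷ route m (childInterval I Y) (childKeys I Y)) (↭-length Y↭))

      #prim-root : fanOut n ≡ α + 1 → ∀ {Y} → Y ↭ xs →
        #prim (route (suc m) I Y) ≡ suc (below 0 Y)
      #prim-root prim Y↭ = trans (cong #prim (root Y↭)) (#prim-∷-yes n _ prim)

      -- In a primary block all `α` stored keys are separators, so `section-size` applies to the
      -- whole pick.
      section-bound : fanOut n ≡ α + 1 →
        suc α * ∑pick α (λ ys zs → size ys zs * length zs !) xs ≤ 2 * (n * n !)
      section-bound prim = begin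
        suc α * ∑pick α (λ ys zs → size ys zs * length zs !) xs
          ≡⟨ cong (suc α *_) (∑pick-cong α xs λ ys zs eq _ →
               cong (λ ys → length (filter (_∈ᴵ? section I ys) zs) * length zs !)
                 (List.take-all (fanOut n ∸ 1) ys (≤-reflexive (trans eq
                   (sym (trans (cong (_∸ 1) prim) (m+n∸n≡m α 1))))))) ⟩
        suc α * ∑pick α (λ ys zs → length (filter (_∈ᴵ? section I ys) zs) * length zs !) xs
          ≤⟨ section-size _ (λ ys → _∈ᴵ? section I ys) (section-neighbours I) α xs ⟩
        2 * (n * n !) ∎

      cases : Dec (fanOut n ≡ α + 1) → ∀ K →
        c * (α + 1) ^ K * ∑ord (λ Y → #prim (route (suc m) I Y) ∸ K) xs ≤ 2 ^ K * n * n !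
      -- Such a root is not counted, and its section has at most `n` keys, so the bound is inherited
      -- without any shrinking.
      cases (no ¬prim) K = begin
        c * (α + 1) ^ K * ∑ord (λ Y → #prim (route (suc m) I Y) ∸ K) xs
          ≡⟨ cong (c * (α + 1) ^ K *_) (∑ord-cong xs λ Y Y↭ →
               cong (_∸ K) (trans (cong #prim (root Y↭)) (#prim-∷-no n _ ¬prim))) ⟩
        c * (α + 1) ^ K * ∑ord (below K) xs
          ≤⟨ below-bound K ⟩
        2 ^ K * ∑pick α (λ ys zs → size ys zs * length zs !) xs
          ≤⟨ *-monoʳ-≤ (2 ^ K) (∑pick-≤ α n size xs λ ys zs zs≤n → ≤-trans (List.length-filter _ zs) zs≤n) ⟩
        2 ^ K * (n * n !)
          ≡⟨ *-assoc (2 ^ K) n (n !) ⟨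
        2 ^ K * n * n ! ∎
      -- The root counts 1, and the rest at most `2 n / ((α + 1) c)` on average. The sum is at most
      -- `n / c` if `(α + 1) c + 2 n ≤ (α + 1) n`, which is `large`.
      cases (yes prim) zero = *-cancelˡ-≤ (suc α) (begin
        suc α * (c * 1 * ∑ord (λ Y → #prim (route (suc m) I Y)) xs)
          ≡⟨ cong (λ t → suc α * (c * 1 * t)) (trans (∑ord-cong xs λ Y Y↭ → #prim-root prim Y↭)
               (trans (∑ord-+ (λ _ → 1) (below 0) xs) (cong (_+ ∑ord (below 0) xs) (∑ord-const 1 xs)))) ⟩
        suc α * (c * 1 * (1 * n ! + ∑ord (below 0) xs))
          ≡⟨ distribute (suc α) c (n !) (∑ord (below 0) xs) ⟩
        suc α * c * n ! + suc α * (c * 1 * ∑ord (below 0) xs)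
          ≤⟨ +-monoʳ-≤ (suc α * c * n !) (*-monoʳ-≤ (suc α) (below-bound 0)) ⟩
        suc α * c * n ! + suc α * (1 * ∑pick α (λ ys zs → size ys zs * length zs !) xs)
          ≡⟨ cong (λ t → suc α * c * n ! + suc α * t) (*-identityˡ _) ⟩
        suc α * c * n ! + suc α * ∑pick α (λ ys zs → size ys zs * length zs !) xs
          ≤⟨ +-mono-≤ (*-monoˡ-≤ (n !) large) (section-bound prim) ⟩
        (α ∸ 1) * n * n ! + 2 * (n * n !)
          ≡⟨ collect (α ∸ 1) n (n !) ⟩
        (2 + (α ∸ 1)) * (1 * n * n !)
          ≡⟨ cong (λ a → suc a * (1 * n * n !)) (m+[n∸m]≡n 1≤α) ⟩
        suc α * (1 * n * n !) ∎)
        where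
        distribute : ∀ a c f g → a * (c * 1 * (1 * f + g)) ≡ a * c * f + a * (c * 1 * g)
        distribute = solve-∀
        collect : ∀ b n f → b * n * f + 2 * (n * f) ≡ (2 + b) * (1 * n * f)
        collect = solve-∀
        α+1≤3[α-1] : suc α ≤ (α ∸ 1) * 3
        α+1≤3[α-1] = begin
          suc α                          ≡⟨ cong suc (m+[n∸m]≡n 1≤α) ⟨
          2 + (α ∸ 1)                    ≤⟨ +-monoˡ-≤ (α ∸ 1) (*-monoˡ-≤ 2 (∸-monoˡ-≤ 1 2≤α)) ⟩
          (α ∸ 1) * 2 + (α ∸ 1)          ≡⟨ +-comm ((α ∸ 1) * 2) _ ⟩
          (α ∸ 1) + (α ∸ 1) * 2          ≡⟨ *-suc (α ∸ 1) 2 ⟨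
          (α ∸ 1) * 3                    ∎
        -- This is (α + 1) · 72 α² ≤ (α - 1) · 216 α², which needs α ≥ 2.
        large : suc α * c ≤ (α ∸ 1) * n
        large = begin
          suc α * c                      ≤⟨ *-monoˡ-≤ c α+1≤3[α-1] ⟩
          (α ∸ 1) * 3 * c                ≡⟨ *-assoc (α ∸ 1) 3 c ⟩
          (α ∸ 1) * (3 * c)              ≡⟨ cong ((α ∸ 1) *_) (*-assoc 3 72 (α * α)) ⟨
          (α ∸ 1) * (216 * (α * α))      ≤⟨ *-monoʳ-≤ (α ∸ 1) (≤-trans (m≤m+n _ α) (<⇒≤ (primary⇒large n prim))) ⟩
          (α ∸ 1) * n                    ∎
      -- The root uses up one unit of `suc K`, and the shrinking of its section supplies one more
      -- factor `2 / (α + 1)`.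
      cases (yes prim) (suc K) = begin
        c * ((α + 1) * (α + 1) ^ K) * ∑ord (λ Y → #prim (route (suc m) I Y) ∸ suc K) xs
          ≡⟨ cong (c * ((α + 1) * (α + 1) ^ K) *_) (∑ord-cong xs λ Y Y↭ →
               cong (_∸ suc K) (#prim-root prim Y↭)) ⟩
        c * ((α + 1) * (α + 1) ^ K) * ∑ord (below K) xs
          ≡⟨ regroup c α ((α + 1) ^ K) (∑ord (below K) xs) ⟩
        suc α * (c * (α + 1) ^ K * ∑ord (below K) xs)
          ≤⟨ *-monoʳ-≤ (suc α) (below-bound K) ⟩
        suc α * (2 ^ K * ∑pick α (λ ys zs → size ys zs * length zs !) xs)
          ≡⟨ ℕ*.x∙yz≈y∙xz (suc α) (2 ^ K) _ ⟩
        2 ^ K * (suc α * ∑pick α (λ ys zs → size ys zs * length zs !) xs)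
          ≤⟨ *-monoʳ-≤ (2 ^ K) (section-bound prim) ⟩
        2 ^ K * (2 * (n * n !))
          ≡⟨ regroup′ (2 ^ K) n (n !) ⟩
        2 * 2 ^ K * n * n ! ∎
        where
        regroup : ∀ c a p s → c * ((a + 1) * p) * s ≡ suc a * (c * p * s)
        regroup = solve-∀
        regroup′ : ∀ p n f → p * (2 * (n * f)) ≡ 2 * p * n * f
        regroup′ = solve-∀

  -- Below a secondary block of fan-out δ and size s ≤ α + δ ρ, the section
  -- of q has expected size at most 2 s / δ = O(ρ), and every further block
  -- on the path but the last removes α of its keys. This gives the bound
  -- 4 + 216 / ε ≤ 218 / ε.

  ∑ord-#sec : ∀ m I xs → v * ∑ord (λ Y → #sec (route m I Y)) xs ≤ 218 * u * length xs !
  ∑ord-#sec = go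
    where
    open ≤-Reasoning

    v≤218u : v ≤ 218 * u
    v≤218u = ≤-trans (m≤m+n v _) (≤-trans 2v≤u (m≤m+n u (217 * u)))

    #sec≤length : ∀ ss → #sec ss ≤ length ss
    #sec≤length = List.length-filter (λ s → fanOut s <? α + 1)

    go : ∀ m I xs → v * ∑ord (λ Y → #sec (route m I Y)) xs ≤ 218 * u * length xs !
    go zero    I xs = ≤-trans (≤-reflexive (trans
      (cong (v *_) (trans (∑ord-cong xs λ Y _ → cong #sec (route-zero I Y)) (∑ord-const 0 xs)))
      (*-zeroʳ v))) z≤n
    go (suc m) I xs with length xs ≤? α
    ... | yes xs≤α = begin
      v * ∑ord (λ Y → #sec (route (suc m) I Y)) xs
        ≤⟨ *-monoʳ-≤ v (∑ord-mono xs λ Y Y↭ → ≤-trans (#sec≤length (route (suc m) I Y))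
             (length-route-small (suc m) I Y (≤-trans (≤-reflexive (↭-length Y↭)) xs≤α))) ⟩
      v * ∑ord (λ _ → 1) xs
        ≡⟨ cong (v *_) (trans (∑ord-const 1 xs) (*-identityˡ _)) ⟩
      v * length xs !
        ≤⟨ *-monoˡ-≤ (length xs !) v≤218u ⟩
      218 * u * length xs ! ∎
    ... | no xs≰α = cases (fanOut n ≟ α + 1)
      where
      n = length xs
      α≤n : α ≤ n
      α≤n = <⇒≤ (≰⇒> xs≰α)

      root : ∀ {Y} → Y ↭ xs → route (suc m) I Y ≡ n ∷ route m (childInterval I Y) (childKeys I Y)
      root {Y} Y↭ = trans (route-suc m I Y (≤-trans (≤-trans 1≤α α≤n) (≤-reflexive (sym (↭-length Y↭)))))
        (cong (_∷ route m (childInterval I Y) (childKeys I Y)) (↭-length Y↭))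

      cases : Dec (fanOut n ≡ α + 1) →
        v * ∑ord (λ Y → #sec (route (suc m) I Y)) xs ≤ 218 * u * n !
      -- The bound does not depend on the size of the list, so it passes through a primary root
      -- unchanged.
      cases (yes prim) = begin
        v * ∑ord (λ Y → #sec (route (suc m) I Y)) xs
          ≡⟨ cong (v *_) (∑ord-cong xs λ Y Y↭ →
               trans (cong #sec (root Y↭)) (#sec-∷-primary n _ prim)) ⟩
        v * ∑ord (λ Y → #sec (route m (childInterval I Y) (childKeys I Y))) xs
          ≤⟨ ∑ord-child v (λ _ → 218 * u) (λ J Y → #sec (route m J Y)) (go m) I xs α≤n ⟩
        ∑pick α (λ ys zs → 218 * u * length zs !) xs
          ≤⟨ ∑pick-≤ α (218 * u) (λ _ _ → 218 * u) xs (λ _ _ _ → ≤-refl) ⟩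
        218 * u * n ! ∎
      -- The factor `suc j`, which is the fan-out, belongs to `∑ord-section`, and `α` to
      -- `α*length-route≤`.
      cases (no ¬prim) = *-cancelˡ-≤ (suc j * α) {{m*n≢0 (suc j) α}} (begin
        suc j * α * (v * ∑ord (λ Y → #sec (route (suc m) I Y)) xs)
          ≡⟨ regroup (suc j) α v (∑ord (λ Y → #sec (route (suc m) I Y)) xs) ⟩
        v * (suc j * (α * ∑ord (λ Y → #sec (route (suc m) I Y)) xs))
          ≡⟨ cong (λ t → v * (suc j * t)) (∑ord-* α (λ Y → #sec (route (suc m) I Y)) xs) ⟨
        v * (suc j * ∑ord (λ Y → α * #sec (route (suc m) I Y)) xs)
          ≤⟨ *-monoʳ-≤ v (*-monoʳ-≤ (suc j) (∑ord-mono xs λ Y Y↭ → pointwise Y Y↭)) ⟩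
        v * (suc j * ∑ord (λ Y → 2 * α + size Y) xs)
          ≡⟨ cong (λ t → v * (suc j * t)) (trans (∑ord-+ (λ _ → 2 * α) size xs)
               (cong (_+ ∑ord size xs) (∑ord-const (2 * α) xs))) ⟩
        v * (suc j * (2 * α * n ! + ∑ord size xs))
          ≡⟨ cong (v *_) (*-distribˡ-+ (suc j) (2 * α * n !) (∑ord size xs)) ⟩
        v * (suc j * (2 * α * n !) + suc j * ∑ord size xs)
          ≤⟨ *-monoʳ-≤ v (+-monoʳ-≤ (suc j * (2 * α * n !)) (∑ord-section I j xs (≤-trans j≤α α≤n))) ⟩
        v * (suc j * (2 * α * n !) + 2 * (n * n !))
          ≡⟨ regroup₂ v (suc j) α (n !) n ⟩
        (suc j * α * (2 * v) + 2 * (n * v)) * n !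
          ≤⟨ *-monoˡ-≤ (n !) (+-monoʳ-≤ (suc j * α * (2 * v)) (*-monoʳ-≤ 2 small)) ⟩
        (suc j * α * (2 * v) + 2 * (α * v + suc j * (108 * α) * u)) * n !
          ≡⟨ cong (_* n !) (regroup₃ (suc j) α v u 108) ⟩
        (suc j * α * (2 * v + 108 * 2 * u) + α * (2 * v)) * n !
          ≤⟨ *-monoˡ-≤ (n !) (+-monoʳ-≤ (suc j * α * (2 * v + 216 * u)) (*-monoˡ-≤ (2 * v) (m≤n*m α (suc j)))) ⟩
        (suc j * α * (2 * v + 216 * u) + suc j * α * (2 * v)) * n !
          -- Here 216 is twice 108. One term `2 v` comes from the root and the last block, the other
          -- from the summand `α` in `s ≤ α + δ ρ`; each is at most `u`, which makes 218.
          ≤⟨ *-monoˡ-≤ (n !) (+-mono-≤ (*-monoʳ-≤ (suc j * α) (+-monoˡ-≤ (216 * u) 2v≤u))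
               (*-monoʳ-≤ (suc j * α) 2v≤u)) ⟩
        (suc j * α * (u + 216 * u) + suc j * α * u) * n !
          ≡⟨ regroup₄ (suc j * α) u 216 (n !) ⟩
        suc j * α * (218 * u * n !) ∎)
        where
        j = fanOut n ∸ 1

        suc-j : suc j ≡ fanOut n
        suc-j = m+[n∸m]≡n (1≤fanOut n)

        j≤α : j ≤ α
        j≤α = ≤-trans (∸-monoˡ-≤ 1 (fanOut≤α+1 n)) (≤-reflexive (m+n∸n≡m α 1))

        small : n * v ≤ α * v + suc j * (108 * α) * u
        small = subst (λ d → n * v ≤ α * v + d * (108 * α) * u) (sym suc-j)
          (secondary⇒small n (≤∧≢⇒< (fanOut≤α+1 n) ¬prim))

        size : List Key → ℕ
        size Y = length (filter (_∈ᴵ? section I (take j Y)) (drop j Y))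

        childKeys≤size : ∀ Y → length Y ≡ n → length (childKeys I Y) ≤ size Y
        childKeys≤size Y eq = begin
          length (filter (_∈ᴵ? section I (take (fanOut (length Y) ∸ 1) Y)) (drop α Y))
            ≡⟨ cong (λ s → length (filter (_∈ᴵ? section I (take (fanOut s ∸ 1) Y)) (drop α Y))) eq ⟩
          length (filter (_∈ᴵ? section I (take j Y)) (drop α Y))
            ≡⟨ cong (λ zs → length (filter (_∈ᴵ? section I (take j Y)) zs))
                 (trans (List.drop-drop j (α ∸ j) Y) (cong (λ i → drop i Y) (m+[n∸m]≡n j≤α))) ⟨
          length (filter (_∈ᴵ? section I (take j Y)) (drop (α ∸ j) (drop j Y)))
            ≤⟨ length-filter-drop (_∈ᴵ? section I (take j Y)) (α ∸ j) (drop j Y) ⟩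
          size Y ∎

        pointwise : ∀ Y → Y ↭ xs → α * #sec (route (suc m) I Y) ≤ 2 * α + size Y
        pointwise Y Y↭ = begin
          α * #sec (route (suc m) I Y)
            -- From here on every block of the route is counted, whatever its fan-out.
            ≤⟨ *-monoʳ-≤ α (#sec≤length (route (suc m) I Y)) ⟩
          α * length (route (suc m) I Y)
            ≡⟨ cong (λ r → α * length r) (root Y↭) ⟩
          α * suc (length (route m (childInterval I Y) (childKeys I Y)))
            ≡⟨ *-suc α _ ⟩
          α + α * length (route m (childInterval I Y) (childKeys I Y))
            ≤⟨ +-monoʳ-≤ α (α*length-route≤ m (childInterval I Y) (childKeys I Y)) ⟩
          α + (length (childKeys I Y) + α)
            ≤⟨ +-monoʳ-≤ α (+-monoˡ-≤ α (childKeys≤size Y (↭-length Y↭))) ⟩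
          α + (size Y + α)
            ≡⟨ regroup₁ α (size Y) ⟩
          2 * α + size Y ∎
          where
          regroup₁ : ∀ a s → a + (s + a) ≡ 2 * a + s
          regroup₁ = solve-∀

        regroup : ∀ d a v s → d * a * (v * s) ≡ v * (d * (a * s))
        regroup = solve-∀
        regroup₂ : ∀ v d a f n → v * (d * (2 * a * f) + 2 * (n * f)) ≡ (d * a * (2 * v) + 2 * (n * v)) * f
        regroup₂ = solve-∀
        regroup₃ : ∀ d a v u c →
          d * a * (2 * v) + 2 * (a * v + d * (c * a) * u) ≡ d * a * (2 * v + c * 2 * u) + a * (2 * v)
        regroup₃ = solve-∀
        regroup₄ : ∀ w u c f → (w * (u + c * u) + w * u) * f ≡ w * ((2 + c) * u * f)
        regroup₄ = solve-∀

-- From permutations to orderings of a list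

sum-map-concatMap : ∀ {a b} {A : Set a} {B : Set b} (f : B → ℕ) (g : A → List B) xs →
  sum (map f (concatMap g xs)) ≡ sum (map (λ x → sum (map f (g x))) xs)
sum-map-concatMap f g []       = refl
sum-map-concatMap f g (x ∷ xs) = trans (cong sum (List.map-++ f (g x) (concatMap g xs)))
  (trans (sum-++ (map f (g x)) _) (cong (sum (map f (g x)) +_) (sum-map-concatMap f g xs)))

sum-map-+ : ∀ {a} {A : Set a} (f g : A → ℕ) xs →
  sum (map (λ x → f x + g x) xs) ≡ sum (map f xs) + sum (map g xs)
sum-map-+ f g []       = refl
sum-map-+ f g (x ∷ xs) = trans (cong (f x + g x +_) (sum-map-+ f g xs))
  (ℕ+.interchange (f x) (g x) (sum (map f xs)) (sum (map g xs)))

sum-map-0 : ∀ {a} {A : Set a} (xs : List A) → sum (map (λ _ → 0) xs) ≡ 0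
sum-map-0 []       = refl
sum-map-0 (_ ∷ xs) = sum-map-0 xs

sum-swap : ∀ {a b} {A : Set a} {B : Set b} (f : A → B → ℕ) xs ys →
  sum (map (λ x → sum (map (f x) ys)) xs) ≡ sum (map (λ y → sum (map (λ x → f x y) xs)) ys)
sum-swap f []       ys = sym (sum-map-0 ys)
sum-swap f (x ∷ xs) ys = trans (cong (sum (map (f x) ys) +_) (sum-swap f xs ys))
  (sym (sum-map-+ (f x) (λ y → sum (map (λ x → f x y) xs)) ys))

module _ {a} {A : Set a} where

  sum-insertAt : ∀ n (f : List A → ℕ) x (g : Fin n → A) →
    sum (tabulate (λ j → f (tabulate (insertAt g j x)))) ≡ ∑ins x f (tabulate g)
  sum-insertAt zero    f x g = +-identityʳ _
  sum-insertAt (suc n) f x g = cong (f (x ∷ tabulate g) +_)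
    (sum-insertAt n (f ∘ (g Fin.zero ∷_)) x (g ∘ Fin.suc))

  -- Key 0 gets priority `j`, and the other keys keep the order that `π` gives them; in the list by
  -- priority this is an insertion at position `j`.
  insert-insertAt : ∀ {n} (X : Fin (suc n) → A) j (π : Permutation′ n) p →
    X (insert Fin.zero j π ⟨$⟩ˡ p) ≡ insertAt (λ i → X (Fin.suc (π ⟨$⟩ˡ i))) j (X Fin.zero) p
  insert-insertAt X j π p with j Fin.≟ p
  ... | yes refl = sym (insertAt-lookup _ j (X Fin.zero))
  ... | no  j≢p  = trans (sym (insertAt-punchIn (λ i → X (Fin.suc (π ⟨$⟩ˡ i))) j (X Fin.zero) (punchOut j≢p)))
    (cong (insertAt (λ i → X (Fin.suc (π ⟨$⟩ˡ i))) j (X Fin.zero)) (Fin.punchIn-punchOut j≢p))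

  -- `permutations` chooses the priority of the first key before ordering the others, `∑ord` after
  -- it; `sum-swap` exchanges the two sums.
  sum-permutations : ∀ n (f : List A → ℕ) (X : Fin n → A) →
    sum (map (λ π → f (tabulate (λ p → X (π ⟨$⟩ˡ p)))) (permutations n)) ≡ ∑ord f (tabulate X)
  sum-permutations zero    f X = +-identityʳ _
  sum-permutations (suc n) f X = begin
    sum (map (λ π → f (keys X π)) (concatMap (λ j → map (insert Fin.zero j) (permutations n)) (allFin (suc n))))
      ≡⟨ sum-map-concatMap (λ π → f (keys X π)) (λ j → map (insert Fin.zero j) (permutations n)) (allFin (suc n)) ⟩
    sum (map (λ j → sum (map (λ π → f (keys X π)) (map (insert Fin.zero j) (permutations n)))) (allFin (suc n)))
      ≡⟨ cong sum (List.map-cong (λ j → cong sum (trans (sym (List.map-∘ (permutations n)))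
           (List.map-cong (λ π → cong f (List.tabulate-cong (insert-insertAt X j π))) (permutations n))))
           (allFin (suc n))) ⟩
    sum (map (λ j → sum (map (λ π → f (tabulate (insertAt (X′ π) j x))) (permutations n))) (allFin (suc n)))
      ≡⟨ sum-swap (λ j π → f (tabulate (insertAt (X′ π) j x))) (allFin (suc n)) (permutations n) ⟩
    sum (map (λ π → sum (map (λ j → f (tabulate (insertAt (X′ π) j x))) (allFin (suc n)))) (permutations n))
      ≡⟨ cong sum (List.map-cong (λ π → trans
           (cong sum (List.map-tabulate id (λ j → f (tabulate (insertAt (X′ π) j x)))))
           (sum-insertAt n f x (X′ π))) (permutations n)) ⟩
    sum (map (λ π → ∑ins x f (keys (X ∘ Fin.suc) π)) (permutations n))
      ≡⟨ sum-permutations n (∑ins x f) (X ∘ Fin.suc) ⟩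
    ∑ord (∑ins x f) (tabulate (X ∘ Fin.suc)) ∎
    where
    open ≡-Reasoning
    x = X Fin.zero
    keys : ∀ {n} → (Fin n → A) → Permutation′ n → List A
    keys X π = tabulate (λ p → X (π ⟨$⟩ˡ p))
    X′ : Permutation′ n → Fin n → A
    X′ π i = X (Fin.suc (π ⟨$⟩ˡ i))

length-filter-map : ∀ {a b p} {A : Set a} {B : Set b} {P : B → Set p} (P? : ∀ y → Dec (P y)) (f : A → B) xs →
  length (filter (P? ∘ f) xs) ≡ length (filter P? (map f xs))
length-filter-map P? f []       = refl
length-filter-map P? f (x ∷ xs) with does (P? (f x))
... | true  = cong suc (length-filter-map P? f xs)
... | false = length-filter-map P? f xs

-- Logarithms and the expected number of primary blocks

∃-log : ∀ b N → 2 ≤ b → 1 ≤ N → ∃[ K ] (b ^ K ≤ N × N < b ^ suc K)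
∃-log b N 2≤b 1≤N = search N (N<b^N N)
  where
  N<b^N : ∀ N → N < b ^ N
  N<b^N zero    = s≤s z≤n
  N<b^N (suc N) = begin
    suc (suc N)      ≤⟨ s≤s (N<b^N N) ⟩
    1 + b ^ N        ≤⟨ +-monoˡ-≤ (b ^ N) (≤-trans (s≤s z≤n) (N<b^N N)) ⟩
    b ^ N + b ^ N    ≡⟨ cong (b ^ N +_) (+-identityʳ (b ^ N)) ⟨
    2 * b ^ N        ≤⟨ *-monoˡ-≤ (b ^ N) 2≤b ⟩
    b * b ^ N        ∎
    where open ≤-Reasoning

  search : ∀ M → N < b ^ M → ∃[ K ] (b ^ K ≤ N × N < b ^ suc K)
  search zero    N<1 = contradiction 1≤N (<⇒≱ N<1)
  search (suc M) N<  with b ^ M ≤? N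
  ... | yes ≤N = M , ≤N , N<
  ... | no  ≰N = search M (≰⇒> ≰N)

^2 : ∀ m → m ^ 2 ≡ m * m
^2 m = cong (m *_) (*-identityʳ m)

m²≤n²⇒m≤n : ∀ {m n} → m * m ≤ n * n → m ≤ n
m²≤n²⇒m≤n {m} {n} m²≤n² with m ≤? n
... | yes m≤n = m≤n
... | no  m≰n = contradiction m²≤n² (<⇒≱ (*-mono-< (≰⇒> m≰n) (≰⇒> m≰n)))

^-distribʳ-* : ∀ k m n → (m * n) ^ k ≡ m ^ k * n ^ k
^-distribʳ-* zero    m n = refl
^-distribʳ-* (suc k) m n = trans (cong (m * n *_) (^-distribʳ-* k m n))
  (ℕ*.interchange m n (m ^ k) (n ^ k))

module _ {k ℓ₁ ℓ₂ : Level} (O : StrictTotalOrder k ℓ₁ ℓ₂) (P : Parameters)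
  (q : StrictTotalOrder.Carrier O) where

  open Parameters P using (α; α-nonZero)
  open ParameterProperties P
  open SearchPath O P q using (route)
  open Bounds O P q
  open StrictTotalOrder O using () renaming (Carrier to Key)

  -- K with α ^ K ≤ n² < α ^ (K + 1) makes n (2 / (α + 1)) ^ K at most α,
  -- since 4 α ≤ (α + 1)².

  ∑ord-#prim : 2 ≤ α → ∀ m I (xs : List Key) → 1 ≤ length xs →
    ∃[ M ] (∑ord (λ Y → #prim (route m I Y)) xs ≤ M * length xs ! × α ^ M ≤ length xs ^ 5)
  ∑ord-#prim 2≤α m I xs 1≤n with length xs ≤? α
  ... | yes n≤α = 0 , ≤-reflexive (trans
      (∑ord-cong xs λ Y Y↭ → #prim-small m I Y (≤-trans (≤-reflexive (↭-length Y↭)) n≤α))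
      (∑ord-const 0 xs)) , m^n>0 (length xs) {{>-nonZero 1≤n}} 5
  -- The unit added to `K` is the bound on the expected excess; its factor `α` in `α ^ M` is paid
  -- for by `α < n`.
  ... | no n≰α = suc K , total , αᴹ≤n⁵
    where
    open ≤-Reasoning
    n = length xs
    instance
      n-nonZero = >-nonZero 1≤n
    log = ∃-log α (n ^ 2) 2≤α (m^n>0 n 2)
    K = proj₁ log
    αᴷ≤n² : α ^ K ≤ n ^ 2
    αᴷ≤n² = proj₁ (proj₂ log)
    n²<αᴷ⁺¹ : n ^ 2 < α ^ suc K
    n²<αᴷ⁺¹ = proj₂ (proj₂ log)
    c = 72 * (α * α)
    D : List Key → ℕ
    D Y = #prim (route m I Y)

    αᴹ≤n⁵ : α ^ suc K ≤ n ^ 5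
    αᴹ≤n⁵ = begin
      α * α ^ K    ≤⟨ *-mono-≤ (<⇒≤ (≰⇒> n≰α)) αᴷ≤n² ⟩
      n * n ^ 2    ≤⟨ ^-monoʳ-≤ n (m≤m+n 3 2) ⟩
      n ^ 5        ∎

    -- The difference of the two sides is the square of `α - 1`.
    4α≤[α+1]² : 4 * α ≤ (α + 1) * (α + 1)
    4α≤[α+1]² = begin
      4 * α                              ≡⟨ cong (4 *_) (m+[n∸m]≡n 1≤α) ⟨
      4 * (1 + (α ∸ 1))                  ≤⟨ m≤m+n _ ((α ∸ 1) * (α ∸ 1)) ⟩
      4 * (1 + (α ∸ 1)) + (α ∸ 1) * (α ∸ 1)  ≡⟨ lemma (α ∸ 1) ⟩
      (1 + (α ∸ 1) + 1) * (1 + (α ∸ 1) + 1)  ≡⟨ cong (λ a → (a + 1) * (a + 1)) (m+[n∸m]≡n 1≤α) ⟩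
      (α + 1) * (α + 1)                  ∎
      where
      lemma : ∀ b → 4 * (1 + b) + b * b ≡ (1 + b + 1) * (1 + b + 1)
      lemma = solve-∀

    -- Both sides are squared because `K` is defined through `n ^ 2` and `4α≤[α+1]²` bounds the
    -- square of `2 / (α + 1)`.
    2ᴷn≤[α+1]ᴷα : 2 ^ K * n ≤ (α + 1) ^ K * α
    2ᴷn≤[α+1]ᴷα = m²≤n²⇒m≤n (begin
      2 ^ K * n * (2 ^ K * n)
        ≡⟨ ℕ*.interchange (2 ^ K) n (2 ^ K) n ⟩
      2 ^ K * 2 ^ K * (n * n)
        ≡⟨ cong₂ _*_ (^-distribʳ-* K 2 2) (^2 n) ⟨
      4 ^ K * n ^ 2
        ≤⟨ *-monoʳ-≤ (4 ^ K) (<⇒≤ n²<αᴷ⁺¹) ⟩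
      4 ^ K * (α * α ^ K)
        ≡⟨ ℕ*.x∙yz≈xz∙y (4 ^ K) α (α ^ K) ⟩
      4 ^ K * α ^ K * α
        ≡⟨ cong (_* α) (^-distribʳ-* K 4 α) ⟨
      (4 * α) ^ K * α
        ≤⟨ *-mono-≤ (^-monoˡ-≤ K 4α≤[α+1]²) (m≤m*n α α) ⟩
      ((α + 1) * (α + 1)) ^ K * (α * α)
        ≡⟨ cong (_* (α * α)) (^-distribʳ-* K (α + 1) (α + 1)) ⟩
      (α + 1) ^ K * (α + 1) ^ K * (α * α)
        ≡⟨ ℕ*.interchange ((α + 1) ^ K) ((α + 1) ^ K) α α ⟩
      (α + 1) ^ K * α * ((α + 1) ^ K * α) ∎)

    excess : ∑ord (λ Y → D Y ∸ K) xs ≤ n !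
    excess = *-cancelˡ-≤ (c * (α + 1) ^ K) (begin
      c * (α + 1) ^ K * ∑ord (λ Y → D Y ∸ K) xs
        ≤⟨ ∑ord-#prim∸ 2≤α m I K xs ⟩
      2 ^ K * n * n !
        ≤⟨ *-monoˡ-≤ (n !) 2ᴷn≤[α+1]ᴷα ⟩
      (α + 1) ^ K * α * n !
        -- The factor `α` left over by the rounding of `K` is absorbed by `c`.
        ≤⟨ *-monoˡ-≤ (n !) (*-monoʳ-≤ ((α + 1) ^ K) (≤-trans (m≤m*n α α) (m≤m+n (α * α) (71 * (α * α))))) ⟩
      (α + 1) ^ K * c * n !
        ≡⟨ cong (_* n !) (*-comm ((α + 1) ^ K) c) ⟩
      c * (α + 1) ^ K * n ! ∎)
      where
      instance
        αα-nonZero = m*n≢0 α α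
        c-nonZero = m*n≢0 72 (α * α)
        α+1-nonZero = >-nonZero (m≤n+m 1 α)
        [α+1]ᴷ-nonZero = m^n≢0 (α + 1) K
        product-nonZero = m*n≢0 c ((α + 1) ^ K)

    total : ∑ord D xs ≤ suc K * n !
    total = begin
      ∑ord D xs                            ≤⟨ ∑ord-mono xs (λ Y _ → m≤n+m∸n (D Y) K) ⟩
      ∑ord (λ Y → K + (D Y ∸ K)) xs        ≡⟨ ∑ord-+ (λ _ → K) (λ Y → D Y ∸ K) xs ⟩
      ∑ord (λ _ → K) xs + ∑ord (λ Y → D Y ∸ K) xs  ≤⟨ +-mono-≤ (≤-reflexive (∑ord-const K xs)) excess ⟩
      K * n ! + n !                        ≡⟨ +-comm (K * n !) (n !) ⟩
      suc K * n !                          ∎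

-- Expectations as rational numbers

open import Data.Integer.Base using (+_)

module _ {n : ℕ} where

  private instance
    n!-nonZero = n !≢0

  𝔼≤ : ∀ (f : Permutation′ n → ℕ) M → sum (map f (permutations n)) ≤ M * n ! → 𝔼 f ℚ.≤ + M / 1
  𝔼≤ f M = /≤/1 (sum (map f (permutations n))) M (n !)

  𝔼≤* : ∀ (f : Permutation′ n → ℕ) c r {u v} → ↥ r ≡ + u → ↧ r ≡ + v →
    v * sum (map f (permutations n)) ≤ c * u * n ! → 𝔼 f ℚ.≤ (+ c / 1) ℚ.* r
  𝔼≤* f c r {u} {v} ↥r≡u ↧r≡v le = /≤/1*⇐ (+ S) (+ c) r (n !) (begin
    + S ℤ.* ↧ r                    ≡⟨ cong (λ d → + S ℤ.* d) ↧r≡v ⟩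
    + S ℤ.* + v                    ≡⟨ ℤ.pos-* S v ⟨
    + (S * v)                      ≡⟨ cong +_ (*-comm S v) ⟩
    + (v * S)                      ≤⟨ ℤ.+≤+ le ⟩
    + (c * u * n !)                ≡⟨ ℤ.pos-* (c * u) (n !) ⟩
    + (c * u) ℤ.* + (n !)          ≡⟨ cong (ℤ._* + (n !)) (ℤ.pos-* c u) ⟩
    + c ℤ.* + u ℤ.* + (n !)        ≡⟨ cong (λ i → + c ℤ.* i ℤ.* + (n !)) ↥r≡u ⟨
    + c ℤ.* ↥ r ℤ.* + (n !)        ∎)
    where
    open ℤ.≤-Reasoning
    S = sum (map f (permutations n))

  𝔼-+ : ∀ (f g h : Permutation′ n → ℕ) → (∀ π → h π ≡ f π + g π) → 𝔼 h ≡ 𝔼 f ℚ.+ 𝔼 g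
  𝔼-+ f g h h≡ = trans
    (cong (λ S → + S / n !) (trans (cong sum (List.map-cong h≡ (permutations n)))
      (sum-map-+ f g (permutations n))))
    (/-distrib-+ (sum (map f (permutations n))) (sum (map g (permutations n))) (n !))

module Expectations {k ℓ₁ ℓ₂ : Level} (O : StrictTotalOrder k ℓ₁ ℓ₂) (P : Parameters)
  (q : StrictTotalOrder.Carrier O) {n : ℕ} (X : Fin n → StrictTotalOrder.Carrier O)
  (q≉X : ∀ i → ¬ (StrictTotalOrder._≈_ O q (X i))) where

  open Parameters P using (α; δ; α-nonZero; 1/ε)
  open ParameterProperties P
  open RBST O P
  open Block
  open SearchPath O P q using (route; path-sizes)
  open Bounds O P q
  open import Data.Tree.AVL.Key O using (⊥⁺; ⊤⁺; ⊥⁺<[_]<⊤⁺)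

  pathSizes : Permutation′ n → List ℕ
  pathSizes π = route n (⊥⁺ , ⊤⁺) (keysByPriority X π)

  searchPath-sizes : ∀ π → map size (searchPath X q π) ≡ pathSizes π
  searchPath-sizes π = path-sizes n (keysByPriority X π) _ (⊥⁺ , ⊤⁺) ⊥⁺<[ q ]<⊤⁺
    (All.tabulate⁺ (λ p → q≉X _))

  #primary≡ : ∀ π → #primary X q π ≡ #prim (pathSizes π)
  #primary≡ π = begin
    length (filter primary? (searchPath X q π))
      ≡⟨ length-filter-map (λ s → δ s ≟ α + 1) size (searchPath X q π) ⟩
    length (filter (λ s → δ s ≟ α + 1) (map size (searchPath X q π)))
      ≡⟨ cong length (List.filter-≐ (λ s → δ s ≟ α + 1) (λ s → fanOut s ≟ α + 1)
           ((λ {s} → subst (_≡ α + 1) (sym (fanOut≡δ s))) , (λ {s} → subst (_≡ α + 1) (fanOut≡δ s)))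
           (map size (searchPath X q π))) ⟩
    #prim (map size (searchPath X q π))
      ≡⟨ cong #prim (searchPath-sizes π) ⟩
    #prim (pathSizes π) ∎
    where open ≡-Reasoning

  #secondary≡ : ∀ π → #secondary X q π ≡ #sec (pathSizes π)
  #secondary≡ π = begin
    length (filter secondary? (searchPath X q π))
      ≡⟨ length-filter-map (λ s → δ s <? α + 1) size (searchPath X q π) ⟩
    length (filter (λ s → δ s <? α + 1) (map size (searchPath X q π)))
      ≡⟨ cong length (List.filter-≐ (λ s → δ s <? α + 1) (λ s → fanOut s <? α + 1)
           ((λ {s} → subst (_< α + 1) (sym (fanOut≡δ s))) , (λ {s} → subst (_< α + 1) (fanOut≡δ s)))
           (map size (searchPath X q π))) ⟩
    #sec (map size (searchPath X q π))
      ≡⟨ cong #sec (searchPath-sizes π) ⟩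
    #sec (pathSizes π) ∎
    where open ≡-Reasoning

  #blocks≡ : ∀ π → #blocks X q π ≡ #primary X q π + #secondary X q π
  #blocks≡ π = begin
    length (searchPath X q π)                  ≡⟨ List.length-map size (searchPath X q π) ⟨
    length (map size (searchPath X q π))       ≡⟨ cong length (searchPath-sizes π) ⟩
    length (pathSizes π)                       ≡⟨ #prim+#sec (pathSizes π) ⟨
    #prim (pathSizes π) + #sec (pathSizes π)   ≡⟨ cong₂ _+_ (#primary≡ π) (#secondary≡ π) ⟨
    #primary X q π + #secondary X q π          ∎
    where open ≡-Reasoning

  sum-pathSizes : ∀ (f : Permutation′ n → ℕ) (g : List ℕ → ℕ) → (∀ π → f π ≡ g (pathSizes π)) →
    sum (map f (permutations n)) ≡ ∑ord (λ Y → g (route n (⊥⁺ , ⊤⁺) Y)) (tabulate X)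
  sum-pathSizes f g f≡g = trans (cong sum (List.map-cong f≡g (permutations n)))
    (sum-permutations n (λ Y → g (route n (⊥⁺ , ⊤⁺) Y)) X)

  length-X : length (tabulate X) ≡ n
  length-X = List.length-tabulate X

  𝔼-#primary : 2 ≤ α → 1 ≤ n → Σ[ M ∈ ℕ ] ((𝔼 (#primary X q) ℚ.≤ + M / 1) × α ^ M ≤ n ^ 5)
  𝔼-#primary 2≤α 1≤n = M
    , 𝔼≤ (#primary X q) M (subst₂ _≤_ (sym (sum-pathSizes (#primary X q) #prim #primary≡))
        (cong (λ l → M * l !) length-X) (proj₁ (proj₂ bound)))
    , subst (λ l → α ^ M ≤ l ^ 5) length-X (proj₂ (proj₂ bound))
    where
    bound = ∑ord-#prim O P q 2≤α n (⊥⁺ , ⊤⁺) (tabulate X) (subst (1 ≤_) (sym length-X) 1≤n)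
    M = proj₁ bound

  𝔼-#secondary : 𝔼 (#secondary X q) ℚ.≤ (+ 218 / 1) ℚ.* 1/ε
  𝔼-#secondary = 𝔼≤* (#secondary X q) 218 1/ε {u} {v} ↥1/ε≡u refl (subst₂ _≤_
    (cong (v *_) (sym (sum-pathSizes (#secondary X q) #sec #secondary≡)))
    (cong (λ l → 218 * u * l !) length-X)
    (∑ord-#sec n (⊥⁺ , ⊤⁺) (tabulate X)))

  𝔼-#blocks : 𝔼 (#blocks X q) ≡ 𝔼 (#primary X q) ℚ.+ 𝔼 (#secondary X q)
  𝔼-#blocks = 𝔼-+ (#primary X q) (#secondary X q) (#blocks X q) #blocks≡

p+q-r≤s : ∀ p q r s → p ℚ.≤ s → q ℚ.≤ r → p ℚ.+ q ℚ.- r ℚ.≤ s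
p+q-r≤s p q r s p≤s q≤r = begin
  p ℚ.+ q ℚ.- r        ≤⟨ ℚ.+-monoˡ-≤ (ℚ.- r) (ℚ.+-mono-≤ p≤s q≤r) ⟩
  s ℚ.+ r ℚ.- r        ≡⟨ ℚ.+-assoc s r (ℚ.- r) ⟩
  s ℚ.+ (r ℚ.- r)      ≡⟨ cong (ℚ._+_ s) (ℚ.+-inverseʳ r) ⟩
  s ℚ.+ ℚ.0ℚ           ≡⟨ ℚ.+-identityʳ s ⟩
  s                    ∎
  where open ℚ.≤-Reasoning

lemma2 : ∀ {k ℓ₁ ℓ₂ : Level} →
    Σ[ C₁ ∈ ℕ ] Σ[ C₂ ∈ ℕ ]
    ((O : StrictTotalOrder k ℓ₁ ℓ₂) (P : Parameters) →
    let open StrictTotalOrder O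
        open Parameters P
        open RBST O P
    in
    2 ≤ α →
    (n : ℕ) → 1 ≤ n →
    (X : Fin n → Carrier) → Injective _≡_ _≈_ X →
    (q : Carrier) → (∀ i → ¬ (q ≈ X i)) →
    (𝔼 (#primary X q) ≤ 5 ·log[ α ] n) ×
    (𝔼 (#secondary X q) ℚ.≤ (+ C₁ / 1) ℚ.* 1/ε) ×
    ((𝔼 (#blocks X q) ℚ.- (+ C₂ / 1) ℚ.* 1/ε) ≤ C₂ ·log[ α ] n))
lemma2 = 218 , 218 , λ O P 2≤α n 1≤n X _ q q≉X →
  let
    open Parameters P
    open RBST O P
    open Expectations O P q X q≉X
    M , 𝔼≤M , αᴹ≤n⁵ = 𝔼-#primary 2≤α 1≤n
    instance n-nonZero = >-nonZero 1≤n
  in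
    ≤·log-intro (𝔼 (#primary X q)) M α n 5 𝔼≤M αᴹ≤n⁵
  , 𝔼-#secondary
  -- Once the bound for secondary blocks is subtracted, the integer bound `M` for primary blocks
  -- remains. One constant serves `1/ε` and the logarithm, so the exponent 5 is raised to 218.
  , ≤·log-intro _ M α n 218
      (subst (λ e → e ℚ.- (+ 218 / 1) ℚ.* 1/ε ℚ.≤ + M / 1) (sym 𝔼-#blocks)
        (p+q-r≤s (𝔼 (#primary X q)) (𝔼 (#secondary X q)) ((+ 218 / 1) ℚ.* 1/ε) (+ M / 1) 𝔼≤M 𝔼-#secondary))
      (≤-trans αᴹ≤n⁵ (^-monoʳ-≤ n (m≤m+n 5 213)))
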